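{- For every $n\ge 6$ there exists no weakly symmetric subspace extension of the permutahedron $\Pi_n$ (with respect to the group $G=S_n$ acting on the vertices by permuting coordinates) with fewer than $\frac{n(n-1)}{2}$ variables; i.e. every weakly symmetric subspace extension $Q\subseteq\mathbb{R}^d$ of $\Pi_n$ satisfies $d\ge\frac{n(n-1)}{2}$.
   Context: The permutahedron $\Pi_n$ is the convex hull of all points of $\mathbb{R}^n$ obtained from $(1,2,\dots,n)$ by permuting coordinates; its vertex set is $X=\{(\zeta^{ -1}(1),\dots,\zeta^{ -1}(n)) : \zeta\in S_n\}$. The group $S_n$ acts on $\mathbb{R}^n$ by $(\pi.x)_v=x_{\pi^{ -1}(v)}$, and $S_d$ acts on $\mathbb{R}^d$ by $(\varkappa.y)_j=y_{\varkappa^{ -1}(j)}$. An extension of a polytope $P\subseteq\mathbb{R}^m$ is a polytope $Q\subseteq\mathbb{R}^d$ with a linear map $p:\mathbb{R}^d\to\mathbb{R}^m$ such that $p(Q)=P$; it is a subspace extension if $Q$ is the intersection of an affine subspace of $\mathbb{R}^d$ with the nonnegative orthant $\mathbb{R}^d_+$. A section is a map $s:X\to Q$ with $s(x)\in Q\cap p^{ -1}(x)$ for all vertices $x\in X$ of $P$. The extension is weakly symmetric with respect to a group $G\subseteq S_m$ acting on $X$ if there is a section $s:X\to Q$ such that for every $\pi\in G$ there is $\varkappa_\pi\in S_d$ with $s(\pi.x)=\varkappa_\pi.s(x)$ for all $x\in X$. -}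

module Defs where

open import Algebra.Apartness.Bundles using (HeytingCommutativeRing; HeytingField)
open import Algebra.Bundles using (CommutativeRing)
open import Algebra.Module.Bundles.Raw using (RawLeftModule)
open import Algebra.Module.Morphism.Structures using (module LeftModuleMorphisms)
open import Data.Fin.Base using (Fin; toℕ)
open import Data.Fin.Permutation using (Permutation′; _⟨$⟩ˡ_; _∘ₚ_)
open import Data.Nat.Base using (ℕ; suc) renaming (_≤_ to _≤ℕ_)
open import Data.Product.Base using (∃; ∃₂; ∃-syntax; _×_; _,_)
open import Data.Sum.Base using (_⊎_)
open import Data.Vec.Functional using (Vector)
open import Function.Bundles using (_⇔_)
open import Level using (Level; _⊔_) renaming (suc to lsuc)
open import Relation.Binary.Core using (Rel)
open import Relation.Binary.Definitions using (_Respects_)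
open import Relation.Binary.Structures using (IsStrictPartialOrder)
open import Relation.Nullary.Negation using (¬_)
open import Relation.Unary using (Pred; _∈_; _∩_; _≐_)

import Algebra.Definitions.RawMonoid as RawMonoidOps
import Data.Vec.Functional.Relation.Binary.Equality.Setoid as VectorEquality

-- The real numbers, up to isomorphism: an Archimedean, Cauchy complete
-- ordered field.  Decidability of the order is not assumed, so that the
-- constructive reals are an instance as well; in the presence of excluded
-- middle, `apart` and `tight` give trichotomy and this is the usual
-- axiomatisation of ℝ.
record RealField c ℓ₁ ℓ₂ ℓ₃ : Set (lsuc (c ⊔ ℓ₁ ⊔ ℓ₂ ⊔ ℓ₃)) where
  field
    heytingField : HeytingField c ℓ₁ ℓ₂

  open HeytingField heytingField public
  open HeytingCommutativeRing heytingCommutativeRing public using (commutativeRing)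
  open CommutativeRing commutativeRing public using (+-rawMonoid)
  open RawMonoidOps +-rawMonoid public using (sum)

  infix 4 _<_ _≤_

  field
    _<_                  : Rel Carrier ℓ₃
    isStrictPartialOrder : IsStrictPartialOrder _≈_ _<_
    apart                : ∀ {x y} → x # y ⇔ (x < y ⊎ y < x)
    +-monoʳ-<            : ∀ x {y z} → y < z → x + y < x + z
    *-pos                : ∀ {x y} → 0# < x → 0# < y → 0# < x * y

  _≤_ : Rel Carrier ℓ₃
  x ≤ y = ¬ (y < x)

  fromℕ : ℕ → Carrier
  fromℕ n = RawMonoidOps._×_ +-rawMonoid n 1#

  Cauchy : (ℕ → Carrier) → Set (c ⊔ ℓ₃)
  Cauchy u = ∀ ε → 0# < ε →
    ∃[ N ] (∀ i j → N ≤ℕ i → N ≤ℕ j → u i - u j < ε)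

  _ConvergesTo_ : (ℕ → Carrier) → Carrier → Set (c ⊔ ℓ₃)
  u ConvergesTo x = ∀ ε → 0# < ε →
    ∃[ N ] (∀ i → N ≤ℕ i → (u i - x < ε) × (x - u i < ε))

  field
    archimedean : ∀ x → ∃[ n ] x < fromℕ n
    complete    : ∀ u → Cauchy u → ∃[ x ] u ConvergesTo x

module Geometry {c ℓ₁ ℓ₂ ℓ₃} (ℝ : RealField c ℓ₁ ℓ₂ ℓ₃) where

  open RealField ℝ
  open VectorEquality setoid public using (_≋_)

  Point : ℕ → Set c
  Point = Vector Carrier

  rawLeftModule : ℕ → RawLeftModule Carrier c ℓ₁
  rawLeftModule n = record
    { Carrierᴹ = Point n
    ; _≈ᴹ_     = _≋_
    ; _+ᴹ_     = λ x y i → x i + y i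
    ; _*ₗ_     = λ r x i → r * x i
    ; 0ᴹ       = λ _ → 0#
    ; -ᴹ_      = λ x i → - x i
    }

  IsLinear : ∀ {d m} → (Point d → Point m) → Set (c ⊔ ℓ₁)
  IsLinear {d} {m} = IsLeftModuleHomomorphism
    where open LeftModuleMorphisms (rawLeftModule d) (rawLeftModule m)

  combination : ∀ {m k} → Vector Carrier k → Vector (Point m) k → Point m
  combination w y v = sum (λ i → w i * y i v)

  NonNegative : ∀ {d} → Pred (Point d) ℓ₃
  NonNegative x = ∀ i → 0# ≤ x i

  conv : ∀ {m a} → Pred (Point m) a → Pred (Point m) (c ⊔ ℓ₁ ⊔ ℓ₃ ⊔ a)
  conv {m} S x = ∃[ k ] ∃₂ λ (w : Vector Carrier k) (y : Vector (Point m) k) →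
    NonNegative w × (sum w ≈ 1#) × (∀ i → y i ∈ S) × (x ≋ combination w y)

  range : ∀ {m k} → Vector (Point m) k → Pred (Point m) ℓ₁
  range y x = ∃[ i ] x ≋ y i

  IsPolytope : ∀ {m q} → Pred (Point m) q → Set (c ⊔ ℓ₁ ⊔ ℓ₃ ⊔ q)
  IsPolytope {m} Q = ∃₂ λ k (y : Vector (Point m) k) → Q ≐ conv (range y)

  image : ∀ {d m q} → (Point d → Point m) → Pred (Point d) q → Pred (Point m) (c ⊔ ℓ₁ ⊔ q)
  image p Q x = ∃[ y ] (y ∈ Q) × (x ≋ p y)

  record IsAffineSubspace {d a} (L : Pred (Point d) a) : Set (c ⊔ ℓ₁ ⊔ a) where
    field
      respects : L Respects _≋_
      closed   : ∀ {k} (w : Vector Carrier k) (y : Vector (Point d) k) →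
                 sum w ≈ 1# → (∀ i → y i ∈ L) → combination w y ∈ L

  record IsExtension {d m a q} (P : Pred (Point m) a) (Q : Pred (Point d) q)
                     (p : Point d → Point m) : Set (c ⊔ ℓ₁ ⊔ ℓ₃ ⊔ a ⊔ q) where
    field
      isPolytope : IsPolytope Q
      isLinear   : IsLinear p
      projection : image p Q ≐ P

  record IsSubspaceExtension {d m a q} l (P : Pred (Point m) a) (Q : Pred (Point d) q)
                             (p : Point d → Point m) : Set (c ⊔ ℓ₁ ⊔ ℓ₃ ⊔ a ⊔ q ⊔ lsuc l) where
    field
      isExtension      : IsExtension P Q p
      L                : Pred (Point d) l
      isAffineSubspace : IsAffineSubspace L
      Q≐L∩orthant      : Q ≐ (L ∩ NonNegative)

    open IsExtension isExtension public

  infixr 7 _•_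

  _•_ : ∀ {m} → Permutation′ m → Point m → Point m
  (π • x) v = x (π ⟨$⟩ˡ v)

  record Section {d m a q} (X : Pred (Point m) a) (Q : Pred (Point d) q)
                 (p : Point d → Point m) : Set (c ⊔ ℓ₁ ⊔ a ⊔ q) where
    field
      s     : ∀ x → x ∈ X → Point d
      cong  : ∀ {x y} (x∈X : x ∈ X) (y∈X : y ∈ X) → x ≋ y → s x x∈X ≋ s y y∈X
      s∈Q   : ∀ x (x∈X : x ∈ X) → s x x∈X ∈ Q
      fibre : ∀ x (x∈X : x ∈ X) → p (s x x∈X) ≋ x

  _ActsOn_ : ∀ {m a g} → Pred (Permutation′ m) g → Pred (Point m) a → Set (c ⊔ a ⊔ g)
  G ActsOn X = ∀ π x → π ∈ G → x ∈ X → π • x ∈ X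

  record IsWeaklySymmetric {d m a g q} (X : Pred (Point m) a) (G : Pred (Permutation′ m) g)
                           (G-acts : G ActsOn X) (Q : Pred (Point d) q)
                           (p : Point d → Point m) : Set (c ⊔ ℓ₁ ⊔ a ⊔ g ⊔ q) where
    field
      section : Section X Q p

    open Section section public

    field
      symmetric : ∀ π (π∈G : π ∈ G) → ∃[ ϰ ]
        (∀ x (x∈X : x ∈ X) → s (π • x) (G-acts π x π∈G x∈X) ≋ ϰ • s x x∈X)

  -- (1, 2, …, n), with Fin n counting from 0
  basePoint : ∀ n → Point n
  basePoint n v = fromℕ (suc (toℕ v))

  -- (ζ • basePoint n) v is ζ⁻¹(v)
  vertices : ∀ n → Pred (Point n) ℓ₁
  vertices n x = ∃[ ζ ] x ≋ ζ • basePoint n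

  permutahedron : ∀ n → Pred (Point n) (c ⊔ ℓ₁ ⊔ ℓ₃)
  permutahedron n = conv (vertices n)

  vertices-stable : ∀ {n g} (G : Pred (Permutation′ n) g) → G ActsOn vertices n
  vertices-stable G π x _ (ζ , x≋ζ) = ζ ∘ₚ π , λ v → x≋ζ (π ⟨$⟩ˡ v)

-- Let u j (ζ) be the j-th coordinate of the section at the vertex ζ, and let
-- matrix (u j) v i be the sum of u j over the permutations ζ with ζ i = v.
-- By symmetry, permuting the rows of such a matrix yields the matrix of another
-- coordinate.  If the rows are neither all equal nor all equal but one, there
-- are already n (n - 1) / 2 distinct rearrangements.  Otherwise every
-- coordinate has a special row v and behaves, for suitable affine combinations
-- of the section, as if it depended on ζ⁻¹ v only, so that it evaluates to
-- Σᵢ m v i · matrix (u j) v i for a prescribed doubly stochastic m.  For each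
-- of the n - 1 cuts {1, …, l} | {l + 1, …, n} we take m on the facet given by
-- the cut and push it slightly outside.  The resulting point violates the
-- facet, so some coordinate is negative at it, which forces its special row to
-- begin or to end exactly at the cut.  Each coordinate does so for at most two
-- cuts, while symmetry provides one for each cut and each v, whence
-- n (n - 1) ≤ 2 d.  As the bound is decidable, finitely many instances of
-- excluded middle may be used, although the order on ℝ is not decidable.
module Submission where

open import Defs
open import Algebra.Bundles using (CommutativeRing)
open import Algebra.Module.Morphism.Structures using (module LeftModuleMorphisms)
open import Data.Bool.Base using (Bool; true; false)
open import Data.Fin.Base
  using (Fin; zero; suc; toℕ; inject₁; inject≤; punchIn; punchOut; splitAt; join; combine; remQuot; _↑ˡ_; _↑ʳ_)
open import Data.Fin.Patterns using (0F; 1F)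
open import Data.Fin.Permutation as Perm
  using (Permutation′; _⟨$⟩ʳ_; _⟨$⟩ˡ_; _∘ₚ_; insert; remove; insert-punchIn; punchIn-permute; transpose)
  renaming (_≈_ to _≈ₚ_)
open import Data.Fin.Properties
  using ( _≟_; all?; any?; ¬∀⟶∃¬; punchInᵢ≢i; punchIn-injective; punchIn-punchOut; inject₁-injective
        ; inject≤-injective; toℕ-injective; toℕ-inject₁; join-splitAt; combine-injective; combine-remQuot
        ; remQuot-combine; injective⇒≤)
open import Data.Nat.Base as ℕ using (ℕ; zero; suc; s≤s; _!)
open import Data.Nat.DivMod using (_/_; m*n/n≡m; /-mono-≤)
import Data.Nat.Properties as ℕₚ
open import Data.Product.Base using (∃; ∃₂; ∃-syntax; _×_; _,_; proj₁; proj₂; uncurry)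
open import Data.Sum.Base using (_⊎_; inj₁; inj₂; [_,_]′)
open import Data.Vec.Functional using (Vector)
open import Function.Base using (_∘_; _on_; const)
open import Function.Bundles using (Equivalence)
open import Level using (Level; _⊔_)
open import Relation.Binary.Core using (Rel)
open import Relation.Binary.PropositionalEquality as ≡ using (_≡_; _≢_)
open import Relation.Binary.Structures using (IsDecEquivalence; IsStrictPartialOrder)
open import Relation.Nullary.Decidable
  using (Dec; yes; no; ¬?; decidable-stable; dec-true; dec-false; ¬¬-excluded-middle)
open import Relation.Nullary.Negation using (¬_; contradiction)
open import Relation.Unary using (Pred; U; _∈_)
import Algebra.Apartness.Properties.HeytingCommutativeRing as Apartness
import Algebra.Properties.Ring as RingProperties
import Algebra.Properties.Semiring.Sum as SemiringSum
import Algebra.Solver.Ring.NaturalCoefficients.Default as SemiringSolver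
import Relation.Binary.Construct.On as On
import Relation.Binary.Reasoning.Setoid as SetoidReasoning

private variable
  ℓ : Level
  n d k N₁ N₂ : ℕ

-- Counting the rearrangements of a colouring.

triangle : ℕ → ℕ
triangle zero    = 0
triangle (suc n) = triangle n ℕ.+ n

-- E compares the colours of positions, so that E (π x) (ρ x) for all x says
-- that π and ρ rearrange the colouring in the same way.
Rearrangements : Rel (Fin n) ℓ → ℕ → Set ℓ
Rearrangements {n} E N = ∃ λ (π : Fin N → Permutation′ n) →
  ∀ {a b} → (∀ x → E (π a ⟨$⟩ʳ x) (π b ⟨$⟩ʳ x)) → a ≡ b

-- `Generic` asks that two colours survive the removal of any one position: the colours are neither
-- all equal nor all equal but one.
Nonconstant Generic : Rel (Fin n) ℓ → Set ℓ
Nonconstant E = ∃₂ λ p q → ¬ E p q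
Generic {n = zero}  E = Nonconstant E
Generic {n = suc n} E = ∀ v → Nonconstant (E on punchIn v)

rearrangements-mono : (E : Rel (Fin n) ℓ) → N₁ ℕ.≤ N₂ → Rearrangements E N₂ → Rearrangements E N₁
rearrangements-mono E le (π , inj) =
  (λ a → π (inject≤ a le)) , λ same → inject≤-injective le le _ _ (inj same)

private
  only : (E : Rel (Fin n) ℓ) → Rearrangements E 1
  only E = (λ _ → Perm.id) , λ { {zero} {zero} _ → ≡.refl }

-- The first family sends `0F` to `p`, the second sends it to `q`. As these have different colours,
-- a member of one family never agrees with a member of the other.
rearrangements-+ : {E : Rel (Fin (suc n)) ℓ} → IsDecEquivalence E → ∀ {p q} → ¬ E p q →
  Rearrangements (E on punchIn p) N₁ → Rearrangements (E on punchIn q) N₂ →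
  Rearrangements E (N₁ ℕ.+ N₂)
rearrangements-+ {n} {N₁ = N₁} {N₂} {E = E} dec {p} {q} ¬pq (π , π-inj) (ρ , ρ-inj) = σ , σ-inj
  where
  open IsDecEquivalence dec using (sym)

  σ′ : Fin N₁ ⊎ Fin N₂ → Permutation′ (suc n)
  σ′ (inj₁ a) = insert 0F p (π a)
  σ′ (inj₂ b) = insert 0F q (ρ b)

  σ = σ′ ∘ splitAt N₁

  σ′-inj : ∀ a b → (∀ x → E (σ′ a ⟨$⟩ʳ x) (σ′ b ⟨$⟩ʳ x)) → a ≡ b
  σ′-inj (inj₁ a) (inj₁ b) same = ≡.cong inj₁ (π-inj λ x →
    ≡.subst₂ E (insert-punchIn 0F p (π a) x) (insert-punchIn 0F p (π b) x) (same (suc x)))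
  σ′-inj (inj₁ a) (inj₂ b) same = contradiction (same 0F) ¬pq
  σ′-inj (inj₂ a) (inj₁ b) same = contradiction (sym (same 0F)) ¬pq
  σ′-inj (inj₂ a) (inj₂ b) same = ≡.cong inj₂ (ρ-inj λ x →
    ≡.subst₂ E (insert-punchIn 0F q (ρ a) x) (insert-punchIn 0F q (ρ b) x) (same (suc x)))

  σ-inj : ∀ {a b} → (∀ x → E (σ a ⟨$⟩ʳ x) (σ b ⟨$⟩ʳ x)) → a ≡ b
  σ-inj {a} {b} same = begin
    a                             ≡⟨ join-splitAt N₁ N₂ a ⟨
    join N₁ N₂ (splitAt N₁ a)     ≡⟨ ≡.cong (join N₁ N₂) (σ′-inj (splitAt N₁ a) (splitAt N₁ b) same) ⟩
    join N₁ N₂ (splitAt N₁ b)     ≡⟨ join-splitAt N₁ N₂ b ⟩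
    b                             ∎
    where open ≡.≡-Reasoning

nonconstant-off : (E : Rel (Fin (suc n)) ℓ) → ∀ {v p q} → v ≢ p → v ≢ q → ¬ E p q →
  Nonconstant (E on punchIn v)
nonconstant-off E v≢p v≢q ¬pq = punchOut v≢p , punchOut v≢q ,
  λ e → ¬pq (≡.subst₂ E (punchIn-punchOut v≢p) (punchIn-punchOut v≢q) e)

module _ {E : Rel (Fin n) ℓ} (dec : IsDecEquivalence E) where
  open IsDecEquivalence dec using () renaming (_≟_ to _E?_; sym to E-sym; trans to E-trans)

  nonconstant? : Dec (Nonconstant E)
  nonconstant? = any? λ p → any? λ q → ¬? (p E? q)

  constant : ¬ Nonconstant E → ∀ p q → E p q
  constant none p q = decidable-stable (p E? q) λ ¬pq → none (p , q , ¬pq)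

  partner : Nonconstant E → ∀ r → ∃ λ q → ¬ E r q
  partner (p , q , ¬pq) r with r E? p
  ... | no ¬rp = p , ¬rp
  ... | yes rp = q , λ rq → ¬pq (E-trans (E-sym rp) rq)

generic? : {E : Rel (Fin n) ℓ} → IsDecEquivalence E → Dec (Generic E)
generic? {n = zero}  dec = nonconstant? dec
generic? {n = suc n} dec = all? λ v → nonconstant? (On.isDecEquivalence (punchIn v) dec)

-- One of the two rests left by removing p or q is again nonconstant.
nonconstant-step : ∀ {n} {E : Rel (Fin (3 ℕ.+ n)) ℓ} → IsDecEquivalence E → Nonconstant E →
  (∀ v → Nonconstant (E on punchIn v) → Rearrangements (E on punchIn v) (2 ℕ.+ n)) →
  Rearrangements E (3 ℕ.+ n)
nonconstant-step {n = n} {E} dec (p , q , ¬pq) off =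
  ≡.subst (Rearrangements E) (ℕₚ.+-comm (2 ℕ.+ n) 1) (split (r E? q))
  where
  open IsDecEquivalence dec using () renaming (_≟_ to _E?_; sym to E-sym; trans to E-trans)

  p≢q : p ≢ q
  p≢q p≡q = ¬pq (IsDecEquivalence.reflexive dec p≡q)
  -- `r` is a third position, distinct from both `p` and `q`.
  q′ = punchOut p≢q
  r′ = punchIn q′ 0F
  r  = punchIn p r′

  r≢p : r ≢ p
  r≢p = punchInᵢ≢i p r′

  r≢q : r ≢ q
  r≢q r≡q = punchInᵢ≢i q′ 0F (punchIn-injective p _ _ (≡.trans r≡q (≡.sym (punchIn-punchOut p≢q))))

  split : Dec (E r q) → Rearrangements E (2 ℕ.+ n ℕ.+ 1)
  split (no ¬rq) = rearrangements-+ dec ¬pq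
    (off p (nonconstant-off E (r≢p ∘ ≡.sym) p≢q ¬rq)) (only (E on punchIn q))
  split (yes rq) = rearrangements-+ dec (¬pq ∘ E-sym)
    (off q (nonconstant-off E (r≢q ∘ ≡.sym) (p≢q ∘ ≡.sym) λ rp → ¬pq (E-trans (E-sym rp) rq)))
    (only (E on punchIn p))

-- Induction on the size: a removal that leaves a nonconstant colouring provides all but one of the
-- rearrangements, and the removal of a differently coloured position provides the last.
nonconstant⇒rearrangements : ∀ n (E : Rel (Fin n) ℓ) → IsDecEquivalence E → Nonconstant E → Rearrangements E n
nonconstant⇒rearrangements 1 E dec _ = only E
nonconstant⇒rearrangements 2 E dec (p , q , ¬pq) =
  rearrangements-+ dec ¬pq (only (E on punchIn p)) (only (E on punchIn q))
nonconstant⇒rearrangements (suc m@(suc (suc _))) E dec nc = nonconstant-step dec nc λ v →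
  nonconstant⇒rearrangements m (E on punchIn v) (On.isDecEquivalence (punchIn v) dec)

-- If removing p leaves one exceptional position v, then all other positions
-- have the colour of a, and removing a keeps the colouring generic.
exceptional-removal : ∀ {m} {E : Rel (Fin (5 ℕ.+ m)) ℓ} → IsDecEquivalence E → Generic E →
  ∀ p v′ → ¬ Nonconstant ((E on punchIn p) on punchIn v′) →
  ∃₂ λ p q → ¬ E p q × Generic (E on punchIn p)
exceptional-removal {m = m} {E} dec gen p v′ ¬nc = a , p , (λ ap → ¬Epa (E-sym ap)) , gen-a
  where
  open IsDecEquivalence dec using () renaming (sym to E-sym; trans to E-trans)
  v = punchIn p v′

  off : Fin (3 ℕ.+ m) → Fin (5 ℕ.+ m)
  off = punchIn p ∘ punchIn v′

  off-E : ∀ s t → E (off s) (off t)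
  off-E = constant (On.isDecEquivalence (punchIn v′) (On.isDecEquivalence (punchIn p) dec)) ¬nc

  a = off 0F

  off≢p : ∀ t → off t ≢ p
  off≢p t = punchInᵢ≢i p _

  off≢v : ∀ t → off t ≢ v
  off≢v t = punchInᵢ≢i v′ t ∘ punchIn-injective p _ _

  off-inj : ∀ {s t} → off s ≡ off t → s ≡ t
  off-inj = punchIn-injective v′ _ _ ∘ punchIn-injective p _ _

  p≢v : p ≢ v
  p≢v = punchInᵢ≢i p v′ ∘ ≡.sym

  off-surj : ∀ x → p ≢ x → v ≢ x → ∃ λ t → off t ≡ x
  off-surj x p≢x v≢x = punchOut v′≢x′ ,
    ≡.trans (≡.cong (punchIn p) (punchIn-punchOut v′≢x′)) (punchIn-punchOut p≢x)
    where
    v′≢x′ : v′ ≢ punchOut p≢x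
    v′≢x′ e = v≢x (≡.trans (≡.cong (punchIn p) e) (punchIn-punchOut p≢x))

  colour : ∀ x → x ≡ p ⊎ x ≡ v ⊎ E x a
  colour x with p ≟ x | v ≟ x
  ... | yes e | _     = inj₁ (≡.sym e)
  ... | no _  | yes e = inj₂ (inj₁ (≡.sym e))
  ... | no p≢x | no v≢x = let t , e = off-surj x p≢x v≢x in
    inj₂ (inj₂ (≡.subst (λ y → E y a) e (off-E t 0F)))

  ¬Epa : ¬ E p a
  -- If `p` had the colour of `a`, then removing `v` would leave a constant colouring. The argument
  -- for `v` exchanges the roles.
  ¬Epa pa = let x , y , ¬xy = gen v in ¬xy (E-trans (all x) (E-sym (all y)))
    where
    all : ∀ x → E (punchIn v x) a
    all x with colour (punchIn v x)
    ... | inj₁ e        = ≡.subst (λ y → E y a) (≡.sym e) pa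
    ... | inj₂ (inj₁ e) = contradiction e (punchInᵢ≢i v x)
    ... | inj₂ (inj₂ e) = e

  ¬Eva : ¬ E v a
  ¬Eva va = let x , y , ¬xy = gen p in ¬xy (E-trans (all x) (E-sym (all y)))
    where
    all : ∀ x → E (punchIn p x) a
    all x with colour (punchIn p x)
    ... | inj₁ e        = contradiction e (punchInᵢ≢i p x)
    ... | inj₂ (inj₁ e) = ≡.subst (λ y → E y a) (≡.sym e) va
    ... | inj₂ (inj₂ e) = e

  -- After `a` and a further position `z` are removed, one of `off 1F` and `off 2F` still has the
  -- colour of `a`, and one of `p` and `v` still has another colour.
  rest : ∀ z → ∃ λ t → z ≢ off (suc t)
  rest z with z ≟ off 1F
  ... | no z≢ = 0F , z≢
  ... | yes ≡.refl = 1F , λ e → contradiction (off-inj e) λ ()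

  deviant : ∀ z → ∃ λ x → z ≢ x × a ≢ x × ¬ E x a
  deviant z with z ≟ p
  ... | no z≢p = p , z≢p , off≢p 0F , ¬Epa
  ... | yes ≡.refl = v , p≢v , off≢v 0F , ¬Eva

  gen-a : Generic (E on punchIn a)
  gen-a v₁ =
    let z = punchIn a v₁
        t , z≢y = rest z
        x , z≢x , a≢x , ¬xa = deviant z
        a≢y = λ e → contradiction (off-inj e) λ ()
        v₁≢ : ∀ {y} (a≢y : a ≢ y) → z ≢ y → v₁ ≢ punchOut a≢y
        v₁≢ a≢y z≢y e = z≢y (≡.trans (≡.cong (punchIn a) e) (punchIn-punchOut a≢y))
    in nonconstant-off (E on punchIn a) (v₁≢ a≢x z≢x) (v₁≢ a≢y z≢y)
         λ e → ¬xa (E-trans (≡.subst₂ E (punchIn-punchOut a≢x) (punchIn-punchOut a≢y) e) (off-E (suc t) 0F))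

-- Either removing `0F` keeps the colouring generic, and then any position of another colour serves
-- as `q`, or a second removal makes it constant, which is the situation of `exceptional-removal`.
generic-removal : ∀ {m} {E : Rel (Fin (5 ℕ.+ m)) ℓ} → IsDecEquivalence E → Generic E →
  ∃₂ λ p q → ¬ E p q × Generic (E on punchIn p)
generic-removal {m = m} {E} dec gen = decide (generic? dec₀)
  where
  dec₀ = On.isDecEquivalence (punchIn 0F) dec

  decide : Dec (Generic (E on punchIn 0F)) → ∃₂ λ p q → ¬ E p q × Generic (E on punchIn p)
  decide (yes gen₀) = let q , ¬pq = partner dec (_ , _ , proj₂ (proj₂ (gen 0F))) 0F in 0F , q , ¬pq , gen₀
  decide (no ¬gen₀) = let v , ¬nc = ¬∀⟶∃¬ _ _ (λ v → nonconstant? (On.isDecEquivalence (punchIn v) dec₀)) ¬gen₀ in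
    exceptional-removal dec gen 0F v ¬nc

module _ {m : ℕ} {E : Rel (Fin (suc m)) ℓ} (dec : IsDecEquivalence E) (gen : Generic E) where
  private
    remaining : ∀ v → Rearrangements (E on punchIn v) m
    remaining v = nonconstant⇒rearrangements m (E on punchIn v) (On.isDecEquivalence (punchIn v) dec) (gen v)

  -- The rearrangements are split by the image of the first position: `p` contributes `triangle m`,
  -- and `q`, whose removal leaves a nonconstant colouring, contributes `m`.
  generic-step : ∀ p q → ¬ E p q → Rearrangements (E on punchIn p) (triangle m) → Rearrangements E (triangle (suc m))
  generic-step p q ¬pq rest = rearrangements-+ dec ¬pq rest (remaining q)

  -- For `m` up to 3 the linear count for nonconstant colourings already reaches `triangle m`, so no
  -- generic removal has to be found.
  generic-small : triangle m ℕ.≤ m → Rearrangements E (triangle (suc m))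
  generic-small le with x , y , ¬xy ← gen 0F =
    generic-step p q ¬xy (rearrangements-mono (E on punchIn p) le (remaining p))
    where
    p = punchIn 0F x
    q = punchIn 0F y

generic⇒rearrangements : ∀ n (E : Rel (Fin n) ℓ) → IsDecEquivalence E → Generic E → Rearrangements E (triangle n)
generic⇒rearrangements 0 E dec gen = (λ ()) , λ { {()} }
generic⇒rearrangements 1 E dec gen = generic-small dec gen ℕₚ.≤-refl
generic⇒rearrangements 2 E dec gen = generic-small dec gen (ℕₚ.n≤1+n _)
generic⇒rearrangements 3 E dec gen = generic-small dec gen (ℕₚ.n≤1+n _)
generic⇒rearrangements 4 E dec gen = generic-small dec gen ℕₚ.≤-refl
generic⇒rearrangements (suc m@(suc (suc (suc (suc _))))) E dec gen =
  let p , q , ¬pq , gen-p = generic-removal dec gen in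
  generic-step dec gen p q ¬pq
    (generic⇒rearrangements m (E on punchIn p) (On.isDecEquivalence (punchIn p) dec) gen-p)

-- Arithmetic of the bound, and transpositions.

triangle-double : ∀ n → n ℕ.* (n ℕ.∸ 1) ≡ triangle n ℕ.* 2
triangle-double zero = ≡.refl
triangle-double (suc zero) = ≡.refl
triangle-double (suc (suc n)) = begin
  (2 ℕ.+ n) ℕ.* (1 ℕ.+ n)             ≡⟨ ℕₚ.*-comm (2 ℕ.+ n) (1 ℕ.+ n) ⟩
  (1 ℕ.+ n) ℕ.* (2 ℕ.+ n)             ≡⟨ ≡.cong ((1 ℕ.+ n) ℕ.*_) (ℕₚ.+-comm 2 n) ⟩
  (1 ℕ.+ n) ℕ.* (n ℕ.+ 2)             ≡⟨ ℕₚ.*-distribˡ-+ (1 ℕ.+ n) n 2 ⟩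
  (1 ℕ.+ n) ℕ.* n ℕ.+ (1 ℕ.+ n) ℕ.* 2 ≡⟨ ≡.cong (ℕ._+ (1 ℕ.+ n) ℕ.* 2) (triangle-double (suc n)) ⟩
  triangle (suc n) ℕ.* 2 ℕ.+ (1 ℕ.+ n) ℕ.* 2 ≡⟨ ℕₚ.*-distribʳ-+ 2 (triangle (suc n)) (1 ℕ.+ n) ⟨
  (triangle (suc n) ℕ.+ (1 ℕ.+ n)) ℕ.* 2 ∎
  where open ≡.≡-Reasoning

half-triangle : ∀ n → n ℕ.* (n ℕ.∸ 1) / 2 ≡ triangle n
half-triangle n = ≡.trans (≡.cong (_/ 2) (triangle-double n)) (m*n/n≡m (triangle n) 2)

transpose-sends : ∀ (a b : Fin n) → transpose a b ⟨$⟩ʳ a ≡ b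
transpose-sends a b rewrite dec-true (a ≟ a) ≡.refl = ≡.refl

transpose-fixes : ∀ {a b x : Fin n} → x ≢ a → x ≢ b → transpose a b ⟨$⟩ʳ x ≡ x
transpose-fixes {a = a} {b} {x} x≢a x≢b rewrite dec-false (x ≟ a) x≢a | dec-false (x ≟ b) x≢b = ≡.refl

⟨$⟩ˡ-cong : (π ρ : Permutation′ n) → π ≈ₚ ρ → ∀ v → π ⟨$⟩ˡ v ≡ ρ ⟨$⟩ˡ v
⟨$⟩ˡ-cong π ρ π≈ρ v = begin
  π ⟨$⟩ˡ v                       ≡⟨ Perm.inverseˡ ρ ⟨
  ρ ⟨$⟩ˡ (ρ ⟨$⟩ʳ (π ⟨$⟩ˡ v))     ≡⟨ ≡.cong (ρ ⟨$⟩ˡ_) (π≈ρ (π ⟨$⟩ˡ v)) ⟨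
  ρ ⟨$⟩ˡ (π ⟨$⟩ʳ (π ⟨$⟩ˡ v))     ≡⟨ ≡.cong (ρ ⟨$⟩ˡ_) (Perm.inverseʳ π) ⟩
  ρ ⟨$⟩ˡ v ∎
  where open ≡.≡-Reasoning

-- Ordered field arithmetic with an undecided order.

module OrderedField {c ℓ₁ ℓ₂ ℓ₃} (ℝ : RealField c ℓ₁ ℓ₂ ℓ₃) where
  open RealField ℝ public hiding (zero)
  open CommutativeRing commutativeRing public using (ring; semiring; commutativeSemiring)
  open IsStrictPartialOrder isStrictPartialOrder public
    using (<-respˡ-≈; <-respʳ-≈) renaming (irrefl to <-irrefl; trans to <-trans; asym to <-asym)
  open SemiringSum semiring public hiding (sum; sum-syntax; sum⁺-syntax)
  open RingProperties ring public using (-‿involutive; -‿distribˡ-*; -‿distribʳ-*)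
  private module Apart = Apartness heytingCommutativeRing
  open SemiringSolver commutativeSemiring public
    using (solve; _:=_; _:+_; _:*_; con)
  module ≈ = SetoidReasoning setoid

  private variable
    w x y z : Carrier

  infixr 5 sum-over

  sum-over : ∀ n → Vector Carrier n → Carrier
  sum-over _ = sum

  syntax sum-over n (λ i → x) = ∑[ i < n ] x

  -- Double negation shift over a finite index set; it lets finitely many classical case
  -- distinctions be made at once when the goal is stable.
  ¬¬-∀ : {P : Fin n → Set ℓ} → (∀ i → ¬ ¬ P i) → ¬ ¬ (∀ i → P i)
  ¬¬-∀ {n = zero}  ps k = k λ ()
  ¬¬-∀ {n = suc n} ps k = ps zero λ p₀ → ¬¬-∀ (ps ∘ suc) λ p → k λ { zero → p₀ ; (suc i) → p i }

  data Trichotomy (x y : Carrier) : Set (ℓ₁ ⊔ ℓ₃) where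
    less    : x < y → Trichotomy x y
    equal   : x ≈ y → Trichotomy x y
    greater : y < x → Trichotomy x y

  -- Tightness turns the failure of both strict comparisons into equality. The double negation does
  -- no harm for `≤`, which is a negation, nor for `≈`, by `≈-stable`.
  ¬¬-trichotomy : ∀ x y → ¬ ¬ Trichotomy x y
  ¬¬-trichotomy x y k = k (equal (proj₁ (tight x y) λ x#y →
    [ k ∘ less , k ∘ greater ]′ (Equivalence.to apart x#y)))

  ≈-stable : ¬ ¬ (x ≈ y) → x ≈ y
  ≈-stable {x} {y} ¬¬e = proj₁ (tight x y) λ x#y → ¬¬e λ x≈y → proj₂ (tight x y) x≈y x#y

  ≤-reflexive : x ≈ y → x ≤ y
  ≤-reflexive x≈y y<x = <-irrefl (sym x≈y) y<x

  <⇒≤ : x < y → x ≤ y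
  <⇒≤ x<y y<x = <-asym x<y y<x

  <-≤-trans : x < y → y ≤ z → ¬ ¬ (x < z)
  <-≤-trans x<y y≤z k = ¬¬-trichotomy _ _ λ where
    (less y<z)  → k (<-trans x<y y<z)
    (equal y≈z) → k (<-respʳ-≈ y≈z x<y)
    (greater z<y) → y≤z z<y

  ≤-trans : x ≤ y → y ≤ z → x ≤ z
  ≤-trans x≤y y≤z z<x = <-≤-trans z<x x≤y y≤z

  ≤-resp : w ≈ x → y ≈ z → w ≤ y → x ≤ z
  ≤-resp w≈x y≈z w≤y z<x = w≤y (<-respˡ-≈ (sym y≈z) (<-respʳ-≈ (sym w≈x) z<x))

  +-monoˡ-< : ∀ x → y < z → y + x < z + x
  +-monoˡ-< x y<z = <-respˡ-≈ (+-comm x _) (<-respʳ-≈ (+-comm x _) (+-monoʳ-< x y<z))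

  -x+[x+y]≈y : ∀ x y → - x + (x + y) ≈ y
  -x+[x+y]≈y x y = trans (sym (+-assoc _ _ _)) (trans (+-congʳ (-‿inverseˡ x)) (+-identityˡ y))

  +-cancelˡ-< : ∀ x → x + y < x + z → y < z
  +-cancelˡ-< x p = <-respˡ-≈ (-x+[x+y]≈y x _) (<-respʳ-≈ (-x+[x+y]≈y x _) (+-monoʳ-< (- x) p))

  +-cancelˡ : ∀ x → x + y ≈ x + z → y ≈ z
  +-cancelˡ x p = trans (sym (-x+[x+y]≈y x _)) (trans (+-congˡ p) (-x+[x+y]≈y x _))

  +-mono-≤ : w ≤ x → y ≤ z → w + y ≤ x + z
  +-mono-≤ {w} {x} {y} {z} w≤x y≤z =
    ≤-trans (w≤x ∘ +-cancelˡ-< y ∘ <-respˡ-≈ (+-comm x y) ∘ <-respʳ-≈ (+-comm w y)) (y≤z ∘ +-cancelˡ-< x)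

  +-cancelˡ-≤ : ∀ x → x + y ≤ x + z → y ≤ z
  +-cancelˡ-≤ x p z<y = p (+-monoʳ-< x z<y)

  0<⇒≉0 : 0# < x → ¬ (x ≈ 0#)
  0<⇒≉0 0<x x≈0 = <-irrefl (sym x≈0) 0<x

  0≤∧≉0⇒¬¬0< : 0# ≤ x → ¬ (x ≈ 0#) → ¬ ¬ (0# < x)
  0≤∧≉0⇒¬¬0< 0≤x x≉0 k = ¬¬-trichotomy _ _ λ where
    (less 0<x)    → k 0<x
    (equal 0≈x)   → x≉0 (sym 0≈x)
    (greater x<0) → 0≤x x<0

  0≤+ : 0# ≤ x → 0# ≤ y → 0# ≤ x + y
  0≤+ 0≤x 0≤y = ≤-resp (+-identityˡ 0#) refl (+-mono-≤ 0≤x 0≤y)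

  0≤* : 0# ≤ x → 0# ≤ y → 0# ≤ x * y
  0≤* {x} {y} 0≤x 0≤y xy<0 = ¬¬-trichotomy 0# x λ where
    (greater x<0) → 0≤x x<0
    (equal 0≈x) → <-irrefl (trans (*-congʳ (sym 0≈x)) (zeroˡ y)) xy<0
    (less 0<x) → ¬¬-trichotomy 0# y λ where
      (greater y<0) → 0≤y y<0
      (equal 0≈y) → <-irrefl (trans (*-congˡ (sym 0≈y)) (zeroʳ x)) xy<0
      (less 0<y) → <-asym xy<0 (*-pos 0<x 0<y)

  *-monoˡ-≤ : 0# ≤ x → y ≤ z → x * y ≤ x * z
  *-monoˡ-≤ {x} {y} {z} 0≤x y≤z = ≤-resp (+-identityˡ _) shift
    (+-mono-≤ (0≤* 0≤x (≤-resp (-‿inverseʳ y) refl (+-mono-≤ y≤z (≤-reflexive refl)))) (≤-reflexive refl))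
    where
    shift : x * (z - y) + x * y ≈ x * z
    shift = trans (sym (distribˡ x _ y)) (*-congˡ
      (trans (+-assoc z (- y) y) (trans (+-congˡ (-‿inverseˡ y)) (+-identityʳ z))))

  0<1 : 0# < 1#
  0<1 with Equivalence.to apart Apart.1#0
  ... | inj₂ 0<1 = 0<1
  ... | inj₁ 1<0 = contradiction 1<0 (<-asym (<-respʳ-≈ square (*-pos 0<-1 0<-1)))
    where
    0<-1 : 0# < - 1#
    0<-1 = <-respˡ-≈ (-‿inverseˡ 1#) (<-respʳ-≈ (+-identityʳ (- 1#)) (+-monoʳ-< (- 1#) 1<0))
    square : - 1# * - 1# ≈ 1#
    square = trans (sym (-‿distribˡ-* 1# (- 1#))) (trans (-‿cong (*-identityˡ (- 1#))) (-‿involutive 1#))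

  0≤fromℕ : ∀ n → 0# ≤ fromℕ n
  0≤fromℕ zero    = ≤-reflexive refl
  0≤fromℕ (suc n) = 0≤+ (<⇒≤ 0<1) (0≤fromℕ n)

  fromℕ-mono-≤ : ∀ {m n} → m ℕ.≤ n → fromℕ m ≤ fromℕ n
  fromℕ-mono-≤ {n = n} ℕ.z≤n = 0≤fromℕ n
  fromℕ-mono-≤ (ℕ.s≤s m≤n) = +-mono-≤ (≤-reflexive refl) (fromℕ-mono-≤ m≤n)

  0<fromℕ-suc : ∀ n → 0# < fromℕ (suc n)
  0<fromℕ-suc zero = <-respʳ-≈ (sym (+-identityʳ 1#)) 0<1
  0<fromℕ-suc (suc n) = <-respˡ-≈ (+-identityʳ 0#)
    (<-trans (+-monoʳ-< 0# (0<fromℕ-suc n)) (+-monoˡ-< (fromℕ (suc n)) 0<1))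

  inverse : 0# < x → ∃[ y ] y * x ≈ 1#
  inverse {x} 0<x with y , yx≈1 , _ ← #⇒invertible (Equivalence.from apart (inj₂ 0<x)) =
    y , trans (*-congˡ (sym (Apart.x-0≈x x))) yx≈1

  *-cancelˡ : 0# < x → x * y ≈ x * z → y ≈ z
  *-cancelˡ {x} {y} {z} 0<x e with i , ix≈1 ← inverse 0<x = trans (sym (undo y)) (trans (*-congˡ e) (undo z))
    where
    undo : ∀ y → i * (x * y) ≈ y
    undo y = trans (sym (*-assoc i x y)) (trans (*-congʳ ix≈1) (*-identityˡ y))

  inverse-pos : 0# < x → y * x ≈ 1# → 0# ≤ y
  inverse-pos {x} {y} 0<x yx≈1 y<0 = <-asym 0<1 (<-respˡ-≈ yx≈1 (<-respʳ-≈ (zeroˡ x) yx<0x))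
    where
    yx<0x : y * x < 0# * x
    yx<0x = <-respˡ-≈ (+-identityʳ _) (<-respʳ-≈ back (+-monoʳ-< (y * x) (*-pos 0<-y 0<x)))
      where
      0<-y : 0# < - y
      0<-y = <-respˡ-≈ (-‿inverseˡ y) (<-respʳ-≈ (+-identityʳ (- y)) (+-monoʳ-< (- y) y<0))
      back : y * x + - y * x ≈ 0# * x
      back = trans (sym (distribʳ x y (- y))) (*-congʳ (-‿inverseʳ y))

  sum-mono-≤ : {f g : Vector Carrier n} → (∀ i → f i ≤ g i) → sum f ≤ sum g
  sum-mono-≤ {n = zero}  f≤g = ≤-reflexive refl
  sum-mono-≤ {n = suc n} f≤g = +-mono-≤ (f≤g zero) (sum-mono-≤ (f≤g ∘ suc))

  0≤sum : {f : Vector Carrier n} → (∀ i → 0# ≤ f i) → 0# ≤ sum f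
  0≤sum {n} 0≤f = ≤-resp (sum-replicate-zero n) refl (sum-mono-≤ 0≤f)

  nonneg-+-zero : 0# ≤ x → 0# ≤ y → x + y ≈ 0# → x ≈ 0#
  nonneg-+-zero {x} {y} 0≤x 0≤y x+y≈0 = ≈-stable λ x≉0 → 0≤∧≉0⇒¬¬0< 0≤x x≉0 λ 0<x →
    0≤y (<-respˡ-≈ (+-identityˡ y) (<-respʳ-≈ x+y≈0 (+-monoˡ-< y 0<x)))

  nonneg-sum-zero : {f : Vector Carrier n} → (∀ i → 0# ≤ f i) → sum f ≈ 0# → ∀ i → f i ≈ 0#
  nonneg-sum-zero 0≤f e zero = nonneg-+-zero (0≤f zero) (0≤sum (0≤f ∘ suc)) e
  nonneg-sum-zero 0≤f e (suc i) = nonneg-sum-zero (0≤f ∘ suc)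
    (nonneg-+-zero (0≤sum (0≤f ∘ suc)) (0≤f zero) (trans (+-comm _ _) e)) i

  0<sum : {f : Vector Carrier n} → (∀ i → 0# ≤ f i) → ∀ i → 0# < f i → ¬ ¬ (0# < sum f)
  0<sum 0≤f i 0<fi = 0≤∧≉0⇒¬¬0< (0≤sum 0≤f) λ e → 0<⇒≉0 0<fi (nonneg-sum-zero 0≤f e i)

  -- For positive `x` this is the Archimedean property applied to the quotient of `y` by `x`; for
  -- zero `x` both sides vanish. All `L` above `K` are covered so that finitely many such bounds can
  -- share one multiplier.
  ¬¬-dominate : 0# ≤ x → (x ≈ 0# → y ≈ 0#) →
    ¬ ¬ (∃[ K ] ∀ L → K ℕ.≤ L → y ≤ fromℕ L * x)
  ¬¬-dominate {x} {y} 0≤x imp k = ¬¬-trichotomy 0# x λ where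
    (greater x<0) → 0≤x x<0
    (equal 0≈x) → k (0 , λ L _ → ≤-reflexive
      (trans (imp (sym 0≈x)) (sym (trans (*-congˡ (sym 0≈x)) (zeroʳ (fromℕ L))))))
    (less 0<x) → let i , ix≈1 = inverse 0<x
                     K , yi<K = archimedean (y * i)
                 in k (K , λ L K≤L → ≤-resp
                        (trans (*-comm x (y * i)) (trans (*-assoc y i x) (trans (*-congˡ ix≈1) (*-identityʳ y))))
                        (*-comm x (fromℕ L))
                        (*-monoˡ-≤ 0≤x (≤-trans (<⇒≤ yi<K) (fromℕ-mono-≤ K≤L))))

-- Sums over all permutations and the matrix of a functional.

module Averages {c ℓ₁ ℓ₂ ℓ₃} (ℝ : RealField c ℓ₁ ℓ₂ ℓ₃) where
  open OrderedField ℝ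

  sum-const : ∀ n x → sum {n} (const x) ≈ fromℕ n * x
  sum-const zero    x = sym (zeroˡ x)
  sum-const (suc n) x = trans (+-cong (sym (*-identityˡ x)) (sum-const n x)) (sym (distribʳ x 1# (fromℕ n)))

  sum-++ : ∀ n {k} (f : Vector Carrier (n ℕ.+ k)) → sum f ≈ sum (f ∘ (_↑ˡ k)) + sum (f ∘ (n ↑ʳ_))
  sum-++ zero    f = sym (+-identityˡ _)
  sum-++ (suc n) f = trans (+-congˡ (sum-++ n (f ∘ suc))) (sym (+-assoc _ _ _))

  sum-combine : ∀ n k (f : Vector Carrier (n ℕ.* k)) → sum f ≈ ∑[ i < n ] ∑[ j < k ] f (combine i j)
  sum-combine zero    k f = refl
  sum-combine (suc n) k f = trans (sum-++ k f) (+-congˡ (sum-combine n k (f ∘ (k ↑ʳ_))))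

  -- The index encodes the image `p` of `zero` and, recursively, the permutation of what remains.
  perms : ∀ n → Vector (Permutation′ n) (n !)
  perms zero    _ = Perm.id
  perms (suc n) i = let p , j = remQuot (n !) i in insert zero p (perms n j)

  Functional : ℕ → Set c
  Functional n = Permutation′ n → Carrier

  -- Permutations that agree as maps need not be equal as records, so invariance under `≈ₚ` is a
  -- condition on a functional.
  Congruent : Functional n → Set ℓ₁
  Congruent F = ∀ π ρ → π ≈ₚ ρ → F π ≈ F ρ

  abstract
    Σₚ : Functional n → Carrier
    Σₚ {n} F = sum (F ∘ perms n)

    Σₚ-def : (F : Functional n) → Σₚ F ≈ sum (F ∘ perms n)
    Σₚ-def F = refl

    Σₚ-cong : {F G : Functional n} → (∀ ζ → F ζ ≈ G ζ) → Σₚ F ≈ Σₚ G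
    Σₚ-cong {n} F≈G = sum-cong-≋ (F≈G ∘ perms n)

    Σₚ-+ : (F G : Functional n) → Σₚ (λ ζ → F ζ + G ζ) ≈ Σₚ F + Σₚ G
    Σₚ-+ {n} F G = ∑-distrib-+ {n !} (F ∘ perms n) (G ∘ perms n)

    Σₚ-* : ∀ x (F : Functional n) → x * Σₚ F ≈ Σₚ (λ ζ → x * F ζ)
    Σₚ-* {n} x F = *-distribˡ-sum {n !} x (F ∘ perms n)

    Σₚ-∑ : (F : Fin k → Functional n) → (∑[ i < k ] Σₚ (F i)) ≈ Σₚ (λ ζ → ∑[ i < k ] F i ζ)
    Σₚ-∑ {k} {n} F = ∑-comm {k} {n !} λ i j → F i (perms n j)

    0≤Σₚ : {F : Functional n} → (∀ ζ → 0# ≤ F ζ) → 0# ≤ Σₚ F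
    0≤Σₚ {n} 0≤F = 0≤sum (0≤F ∘ perms n)

    Σₚ-suc : (F : Functional (suc n)) → Σₚ F ≈ ∑[ p < suc n ] Σₚ (F ∘ insert zero p)
    Σₚ-suc {n} F = trans (sum-combine (suc n) (n !) _) (sum-cong-≋ {suc n} λ p → sum-cong-≋ λ j →
      reflexive (≡.cong (λ pj → F (uncurry (λ p j → insert zero p (perms n j)) pj)) (remQuot-combine p j)))

  insert-cong : ∀ p {π ρ : Permutation′ n} → π ≈ₚ ρ → insert zero p π ≈ₚ insert zero p ρ
  insert-cong p π≈ρ zero = ≡.refl
  insert-cong p {π} {ρ} π≈ρ (suc x) = begin
    insert zero p π ⟨$⟩ʳ suc x ≡⟨ insert-punchIn zero p π x ⟩
    punchIn p (π ⟨$⟩ʳ x)       ≡⟨ ≡.cong (punchIn p) (π≈ρ x) ⟩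
    punchIn p (ρ ⟨$⟩ʳ x)       ≡⟨ insert-punchIn zero p ρ x ⟨
    insert zero p ρ ⟨$⟩ʳ suc x ∎
    where open ≡.≡-Reasoning

  insert-∘ₚ : ∀ p (ζ : Permutation′ n) (π : Permutation′ (suc n)) →
    insert zero p ζ ∘ₚ π ≈ₚ insert zero (π ⟨$⟩ʳ p) (ζ ∘ₚ remove p π)
  insert-∘ₚ p ζ π zero = ≡.refl
  insert-∘ₚ p ζ π (suc x) = begin
    π ⟨$⟩ʳ (insert zero p ζ ⟨$⟩ʳ suc x)                       ≡⟨ ≡.cong (π ⟨$⟩ʳ_) (insert-punchIn zero p ζ x) ⟩
    π ⟨$⟩ʳ punchIn p (ζ ⟨$⟩ʳ x)                               ≡⟨ punchIn-permute π p (ζ ⟨$⟩ʳ x) ⟩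
    punchIn (π ⟨$⟩ʳ p) (remove p π ⟨$⟩ʳ (ζ ⟨$⟩ʳ x))           ≡⟨ insert-punchIn zero (π ⟨$⟩ʳ p) (ζ ∘ₚ remove p π) x ⟨
    insert zero (π ⟨$⟩ʳ p) (ζ ∘ₚ remove p π) ⟨$⟩ʳ suc x       ∎
    where open ≡.≡-Reasoning

  -- Induction along the image `p` of `zero`: composition with `π` changes it to `π ⟨$⟩ʳ p` and
  -- translates the remaining permutation by `remove p π`. The inner sums are invariant by
  -- induction, and the outer sum is merely permuted by `π`.
  Σₚ-translate : (F : Functional n) → Congruent F → ∀ π → Σₚ (λ ζ → F (ζ ∘ₚ π)) ≈ Σₚ F
  Σₚ-translate {zero}  F F-cong π = Σₚ-cong λ ζ → F-cong (ζ ∘ₚ π) ζ λ ()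
  Σₚ-translate {suc n} F F-cong π = begin
    Σₚ (λ ζ → F (ζ ∘ₚ π))
      ≈⟨ Σₚ-suc _ ⟩
    (∑[ p < suc n ] Σₚ λ ζ → F (insert zero p ζ ∘ₚ π))
      ≈⟨ sum-cong-≋ {suc n} (λ p → Σₚ-cong {n} λ ζ →
           F-cong (insert zero p ζ ∘ₚ π) (insert zero (π ⟨$⟩ʳ p) (ζ ∘ₚ remove p π)) (insert-∘ₚ p ζ π)) ⟩
    (∑[ p < suc n ] Σₚ λ ζ → F (insert zero (π ⟨$⟩ʳ p) (ζ ∘ₚ remove p π)))
      ≈⟨ sum-cong-≋ {suc n} (λ p → Σₚ-translate (F ∘ insert zero (π ⟨$⟩ʳ p))
           (λ σ ρ σ≈ρ → F-cong _ _ (insert-cong (π ⟨$⟩ʳ p) {σ} {ρ} σ≈ρ)) (remove p π)) ⟩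
    (∑[ p < suc n ] Σₚ (F ∘ insert zero (π ⟨$⟩ʳ p)))
      ≈⟨ sum-permute (λ p → Σₚ (F ∘ insert zero p)) π ⟨
    (∑[ p < suc n ] Σₚ (F ∘ insert zero p))
      ≈⟨ Σₚ-suc F ⟨
    Σₚ F ∎
    where open ≈

  indicator : {A : Set ℓ} → Dec A → Carrier
  indicator (yes _) = 1#
  indicator (no _)  = 0#

  δ : Fin n → Fin n → Carrier
  δ x y = indicator (x ≟ y)

  δ-refl : (x : Fin n) → δ x x ≈ 1#
  δ-refl x with x ≟ x
  ... | yes _ = refl
  ... | no x≢x = contradiction ≡.refl x≢x

  δ-≢ : {x y : Fin n} → x ≢ y → δ x y ≈ 0#
  δ-≢ {x = x} {y} x≢y with x ≟ y
  ... | yes x≡y = contradiction x≡y x≢y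
  ... | no _ = refl

  0≤δ : (x y : Fin n) → 0# ≤ δ x y
  0≤δ x y with x ≟ y
  ... | yes _ = <⇒≤ 0<1
  ... | no _  = ≤-reflexive refl

  δ-⟨$⟩ʳ : (π : Permutation′ n) → ∀ x y → δ (π ⟨$⟩ʳ x) (π ⟨$⟩ʳ y) ≈ δ x y
  δ-⟨$⟩ʳ π x y with x ≟ y
  ... | yes ≡.refl = δ-refl (π ⟨$⟩ʳ x)
  ... | no x≢y = δ-≢ λ e → x≢y (≡.trans (≡.sym (Perm.inverseˡ π)) (≡.trans (≡.cong (π ⟨$⟩ˡ_) e) (Perm.inverseˡ π)))

  δ-subst : (f : Fin n → Carrier) → ∀ x y → δ x y * f x ≈ δ x y * f y
  δ-subst f x y with x ≟ y
  ... | yes ≡.refl = refl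
  ... | no _ = trans (zeroˡ _) (sym (zeroˡ _))

  sum-supported : ∀ (v : Fin n) f → (∀ x → v ≢ x → f x ≈ 0#) → sum f ≈ f v
  sum-supported {suc n} v f off = begin
    sum f                         ≈⟨ sum-remove {i = v} f ⟩
    f v + sum (f ∘ punchIn v)     ≈⟨ +-congˡ (sum-cong-≋ {n} λ x → off _ (punchInᵢ≢i v x ∘ ≡.sym)) ⟩
    f v + sum {n} (const 0#)      ≈⟨ +-congˡ (sum-replicate-zero n) ⟩
    f v + 0#                      ≈⟨ +-identityʳ (f v) ⟩
    f v ∎
    where open ≈

  sum-δ : ∀ (v : Fin n) (f : Fin n → Carrier) → (∑[ x < n ] δ v x * f x) ≈ f v
  sum-δ v f = trans
    (sum-supported v _ λ x v≢x → trans (*-congʳ (δ-≢ v≢x)) (zeroˡ _))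
    (trans (*-congʳ (δ-refl v)) (*-identityˡ _))

  sum-δ′ : ∀ (v : Fin n) (f : Fin n → Carrier) → (∑[ x < n ] δ x v * f x) ≈ f v
  sum-δ′ v f = trans
    (sum-supported v _ λ x v≢x → trans (*-congʳ (δ-≢ (v≢x ∘ ≡.sym))) (zeroˡ _))
    (trans (*-congʳ (δ-refl v)) (*-identityˡ _))

  matrix : Functional n → Fin n → Fin n → Carrier
  matrix F v i = Σₚ λ ζ → δ (ζ ⟨$⟩ʳ i) v * F ζ

  matrix-column : (F : Functional n) → ∀ i → (∑[ v < n ] matrix F v i) ≈ Σₚ F
  matrix-column F i = trans (Σₚ-∑ λ v ζ → δ (ζ ⟨$⟩ʳ i) v * F ζ)
    (Σₚ-cong λ ζ → sum-δ (ζ ⟨$⟩ʳ i) (const (F ζ)))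

  matrix-row : (F : Functional n) → ∀ v → (∑[ i < n ] matrix F v i) ≈ Σₚ F
  matrix-row {n} F v = trans (Σₚ-∑ λ i ζ → δ (ζ ⟨$⟩ʳ i) v * F ζ) (Σₚ-cong λ ζ → begin
    (∑[ i < n ] δ (ζ ⟨$⟩ʳ i) v * F ζ)     ≈⟨ sum-permute (λ x → δ x v * F ζ) ζ ⟨
    (∑[ x < n ] δ x v * F ζ)              ≈⟨ sum-δ′ v (const (F ζ)) ⟩
    F ζ ∎)
    where open ≈

  matrix-cong : {F G : Functional n} → (∀ ζ → F ζ ≈ G ζ) → ∀ v i → matrix F v i ≈ matrix G v i
  matrix-cong F≈G v i = Σₚ-cong λ ζ → *-congˡ (F≈G ζ)

  -- Since `ζ` sends `i` to `v` exactly when `ζ ∘ₚ π` sends `i` to `π ⟨$⟩ʳ v`, translation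
  -- invariance applies. This is how symmetry acts on matrices by permuting rows.
  matrix-translate : (F : Functional n) → Congruent F → ∀ π v i →
    matrix (λ ζ → F (ζ ∘ₚ π)) v i ≈ matrix F (π ⟨$⟩ʳ v) i
  matrix-translate F F-cong π v i = trans
    (Σₚ-cong λ ζ → *-congʳ (sym (δ-⟨$⟩ʳ π (ζ ⟨$⟩ʳ i) v)))
    (Σₚ-translate (λ ζ → δ (ζ ⟨$⟩ʳ i) (π ⟨$⟩ʳ v) * F ζ)
      (λ σ ρ σ≈ρ → *-cong (reflexive (≡.cong (λ x → δ x (π ⟨$⟩ʳ v)) (σ≈ρ i))) (F-cong σ ρ σ≈ρ)) π)

  0≤matrix : {F : Functional n} → (∀ ζ → 0# ≤ F ζ) → ∀ v i → 0# ≤ matrix F v i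
  0≤matrix 0≤F v i = 0≤Σₚ λ ζ → 0≤* (0≤δ (ζ ⟨$⟩ʳ i) v) (0≤F ζ)

  -- In the terms that contribute, `ζ` sends `i` to `v`, so the extra factor is constantly `f i`.
  matrix-scale : (F : Functional n) → ∀ v i (f : Fin n → Carrier) →
    matrix (λ ζ → f (ζ ⟨$⟩ˡ v) * F ζ) v i ≈ f i * matrix F v i
  matrix-scale F v i f = begin
    Σₚ (λ ζ → δ (ζ ⟨$⟩ʳ i) v * (f (ζ ⟨$⟩ˡ v) * F ζ))
      ≈⟨ Σₚ-cong (λ ζ → trans (sym (*-assoc _ _ _)) (trans (*-congʳ (swap ζ)) (*-assoc _ _ _))) ⟩
    Σₚ (λ ζ → f i * (δ (ζ ⟨$⟩ʳ i) v * F ζ))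
      ≈⟨ Σₚ-* (f i) (λ ζ → δ (ζ ⟨$⟩ʳ i) v * F ζ) ⟨
    f i * matrix F v i ∎
    where
    open ≈
    swap : ∀ ζ → δ (ζ ⟨$⟩ʳ i) v * f (ζ ⟨$⟩ˡ v) ≈ f i * δ (ζ ⟨$⟩ʳ i) v
    swap ζ = trans (sym (δ-subst (f ∘ (ζ ⟨$⟩ˡ_)) (ζ ⟨$⟩ʳ i) v))
      (trans (*-congˡ (reflexive (≡.cong f (Perm.inverseˡ ζ)))) (*-comm _ _))

  Special : (Fin n → Fin n → Carrier) → Fin n → Set ℓ₁
  Special M v = ∀ x y → v ≢ x → v ≢ y → ∀ i → M x i ≈ M y i

  sum-special : ∀ (v : Fin n) (f : Fin n → Carrier) a → (∀ x → v ≢ x → f x ≈ a) →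
    sum f + a ≈ f v + fromℕ n * a
  sum-special {suc n} v f a off = begin
    sum f + a                          ≈⟨ +-congʳ (sum-remove {i = v} f) ⟩
    f v + sum (f ∘ punchIn v) + a      ≈⟨ +-congʳ (+-congˡ (sum-cong-≋ {n} λ x → off _ (punchInᵢ≢i v x ∘ ≡.sym))) ⟩
    f v + sum {n} (const a) + a        ≈⟨ +-congʳ (+-congˡ (sum-const n a)) ⟩
    f v + fromℕ n * a + a              ≈⟨ solve 3 (λ x k a → x :+ k :* a :+ a := x :+ (con 1 :+ k) :* a) refl (f v) (fromℕ n) a ⟩
    f v + fromℕ (suc n) * a ∎
    where open ≈

  -- The column sums determine the entries outside the row v; the terms are
  -- arranged so that no subtraction occurs.
  special-entry : (F : Functional n) → ∀ {v} → Special (matrix F) v → ∀ x i →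
    fromℕ n * matrix F x i + (matrix F v i + δ v x * Σₚ F) ≈
    Σₚ F + (matrix F x i + δ v x * (fromℕ n * matrix F v i))
  special-entry {n} F {v} special x i with v ≟ x
  ... | yes ≡.refl = solve 3 (λ k a t → k :* a :+ (a :+ con 1 :* t) := t :+ (a :+ con 1 :* (k :* a)))
                       refl (fromℕ n) (matrix F v i) (Σₚ F)
  ... | no v≢x = begin
    fromℕ n * matrix F x i + (matrix F v i + 0# * Σₚ F)
      ≈⟨ solve 3 (λ a b t → a :+ (b :+ con 0 :* t) := b :+ a) refl (fromℕ n * matrix F x i) (matrix F v i) (Σₚ F) ⟩
    matrix F v i + fromℕ n * matrix F x i
      ≈⟨ sum-special v (λ y → matrix F y i) (matrix F x i) (λ y v≢y → special y x v≢y v≢x i) ⟨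
    (∑[ y < n ] matrix F y i) + matrix F x i
      ≈⟨ +-congʳ (matrix-column F i) ⟩
    Σₚ F + matrix F x i
      ≈⟨ solve 3 (λ t a b → t :+ a := t :+ (a :+ con 0 :* b)) refl (Σₚ F) (matrix F x i) (fromℕ n * matrix F v i) ⟩
    Σₚ F + (matrix F x i + 0# * (fromℕ n * matrix F v i)) ∎
    where open ≈

  -- Weights on permutations that evaluate functionals with a special row.

  module Weighted {n : ℕ} (k : Carrier) (n≈2+k : fromℕ n ≈ 1# + (1# + k)) (m : Fin n → Fin n → Carrier) (r : Carrier)
    (row : ∀ v → (∑[ i < n ] m v i) ≈ r) (column : ∀ i → (∑[ v < n ] m v i) ≈ r) where

    trace : Functional n
    trace ζ = ∑[ i < n ] m (ζ ⟨$⟩ʳ i) i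

    -- The coefficients are chosen so that functionals with a special row v sum
    -- to fromℕ n * Σᵢ m v i * matrix F v i, see Σₚ-weight.
    weight : Functional n
    weight ζ = (1# + k) * trace ζ + - (k * r)

    Σₚ-trace : (F : Functional n) → Σₚ (λ ζ → trace ζ * F ζ) ≈ ∑[ x < n ] ∑[ i < n ] m x i * matrix F x i
    Σₚ-trace F = begin
      Σₚ (λ ζ → trace ζ * F ζ)
        ≈⟨ Σₚ-cong (λ ζ → trans (*-distribʳ-sum {n} (F ζ) λ i → m (ζ ⟨$⟩ʳ i) i) (sum-cong-≋ {n} λ i → expand ζ i)) ⟩
      Σₚ (λ ζ → ∑[ i < n ] ∑[ x < n ] m x i * (δ (ζ ⟨$⟩ʳ i) x * F ζ))
        ≈⟨ Σₚ-∑ (λ i ζ → ∑[ x < n ] m x i * (δ (ζ ⟨$⟩ʳ i) x * F ζ)) ⟨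
      (∑[ i < n ] Σₚ λ ζ → ∑[ x < n ] m x i * (δ (ζ ⟨$⟩ʳ i) x * F ζ))
        ≈⟨ sum-cong-≋ {n} (λ i → Σₚ-∑ (λ x ζ → m x i * (δ (ζ ⟨$⟩ʳ i) x * F ζ))) ⟨
      (∑[ i < n ] ∑[ x < n ] Σₚ λ ζ → m x i * (δ (ζ ⟨$⟩ʳ i) x * F ζ))
        ≈⟨ sum-cong-≋ {n} (λ i → sum-cong-≋ {n} λ x → Σₚ-* (m x i) (λ ζ → δ (ζ ⟨$⟩ʳ i) x * F ζ)) ⟨
      (∑[ i < n ] ∑[ x < n ] m x i * matrix F x i)
        ≈⟨ ∑-comm {n} {n} (λ i x → m x i * matrix F x i) ⟩
      (∑[ x < n ] ∑[ i < n ] m x i * matrix F x i) ∎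
      where
      open ≈
      expand : ∀ ζ i → m (ζ ⟨$⟩ʳ i) i * F ζ ≈ ∑[ x < n ] m x i * (δ (ζ ⟨$⟩ʳ i) x * F ζ)
      expand ζ i = begin
        m (ζ ⟨$⟩ʳ i) i * F ζ
          ≈⟨ sum-δ (ζ ⟨$⟩ʳ i) (λ x → m x i * F ζ) ⟨
        (∑[ x < n ] δ (ζ ⟨$⟩ʳ i) x * (m x i * F ζ))
          ≈⟨ sum-cong-≋ {n} (λ x → solve 3 (λ a b c → a :* (b :* c) := b :* (a :* c)) refl (δ (ζ ⟨$⟩ʳ i) x) (m x i) (F ζ)) ⟩
        (∑[ x < n ] m x i * (δ (ζ ⟨$⟩ʳ i) x * F ζ)) ∎

    module _ (F : Functional n) {v : Fin n} (special : Special (matrix F) v) where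
      private
        Sₓ : Fin n → Carrier
        Sₓ x = ∑[ i < n ] m x i * matrix F x i
        Rₓ : Fin n → Carrier
        Rₓ x = ∑[ i < n ] m x i * matrix F v i
        S P T νN : Carrier
        S = ∑[ x < n ] Sₓ x
        P = Rₓ v
        T = Σₚ F
        νN = fromℕ n

        spread : ∀ x t → r * t ≈ ∑[ i < n ] m x i * t
        spread x t = trans (*-congʳ (sym (row x))) (*-distribʳ-sum {n} t (m x))

        -- `special-entry` is multiplied by `m x i` and summed over `i`; `total` then sums over `x`,
        -- where the column sums of `m` enter through `cross`.
        entry-row : ∀ x → νN * Sₓ x + (Rₓ x + δ v x * (r * T)) ≈ r * T + (Sₓ x + δ v x * (νN * P))
        entry-row x = begin
          νN * Sₓ x + (Rₓ x + δ v x * (r * T))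
            ≈⟨ +-cong (*-distribˡ-sum {n} νN λ i → m x i * matrix F x i)
                 (+-congˡ (trans (*-congˡ (spread x T)) (*-distribˡ-sum {n} (δ v x) λ i → m x i * T))) ⟩
          (∑[ i < n ] νN * (m x i * matrix F x i)) + (Rₓ x + (∑[ i < n ] δ v x * (m x i * T)))
            ≈⟨ +-congˡ (∑-distrib-+ {n} (λ i → m x i * matrix F v i) (λ i → δ v x * (m x i * T))) ⟨
          (∑[ i < n ] νN * (m x i * matrix F x i)) + (∑[ i < n ] m x i * matrix F v i + δ v x * (m x i * T))
            ≈⟨ ∑-distrib-+ {n} (λ i → νN * (m x i * matrix F x i)) (λ i → m x i * matrix F v i + δ v x * (m x i * T)) ⟨
          (∑[ i < n ] νN * (m x i * matrix F x i) + (m x i * matrix F v i + δ v x * (m x i * T)))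
            ≈⟨ sum-cong-≋ {n} (λ i → solve 6 (λ k w a b d t →
                 k :* (w :* a) :+ (w :* b :+ d :* (w :* t)) := w :* (k :* a :+ (b :+ d :* t)))
                 refl νN (m x i) (matrix F x i) (matrix F v i) (δ v x) T) ⟩
          (∑[ i < n ] m x i * (νN * matrix F x i + (matrix F v i + δ v x * T)))
            ≈⟨ sum-cong-≋ {n} (λ i → *-congˡ (special-entry F special x i)) ⟩
          (∑[ i < n ] m x i * (T + (matrix F x i + δ v x * (νN * matrix F v i))))
            ≈⟨ sum-cong-≋ {n} (λ i → trans (solve 6 (λ w t d k a b →
                 w :* (t :+ (b :+ d :* (k :* a))) := w :* t :+ (w :* b :+ k :* a :* (d :* w)))
                 refl (m x i) T (δ v x) νN (matrix F v i) (matrix F x i))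
                 (+-congˡ (+-congˡ (trans (*-congˡ (sym (δ-subst (λ y → m y i) v x)))
                   (solve 4 (λ k a d w → k :* a :* (d :* w) := d :* (k :* (w :* a)))
                     refl νN (matrix F v i) (δ v x) (m v i)))))) ⟩
          (∑[ i < n ] m x i * T + (m x i * matrix F x i + δ v x * (νN * (m v i * matrix F v i))))
            ≈⟨ trans (∑-distrib-+ {n} (λ i → m x i * T) (λ i → m x i * matrix F x i + δ v x * (νN * (m v i * matrix F v i))))
                 (+-congˡ (∑-distrib-+ {n} (λ i → m x i * matrix F x i) (λ i → δ v x * (νN * (m v i * matrix F v i))))) ⟩
          (∑[ i < n ] m x i * T) + (Sₓ x + (∑[ i < n ] δ v x * (νN * (m v i * matrix F v i))))
            ≈⟨ +-cong (sym (spread x T)) (+-congˡ (trans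
                 (sym (*-distribˡ-sum {n} (δ v x) λ i → νN * (m v i * matrix F v i)))
                 (*-congˡ (sym (*-distribˡ-sum {n} νN λ i → m v i * matrix F v i))))) ⟩
          r * T + (Sₓ x + δ v x * (νN * P)) ∎
          where open ≈

        cross : (∑[ x < n ] Rₓ x) ≈ r * T
        cross = begin
          (∑[ x < n ] ∑[ i < n ] m x i * matrix F v i)   ≈⟨ ∑-comm {n} {n} (λ x i → m x i * matrix F v i) ⟩
          (∑[ i < n ] ∑[ x < n ] m x i * matrix F v i)   ≈⟨ sum-cong-≋ {n} (λ i → *-distribʳ-sum {n} (matrix F v i) λ x → m x i) ⟨
          (∑[ i < n ] (∑[ x < n ] m x i) * matrix F v i) ≈⟨ sum-cong-≋ {n} (λ i → *-congʳ (column i)) ⟩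
          (∑[ i < n ] r * matrix F v i)                  ≈⟨ *-distribˡ-sum {n} r (matrix F v) ⟨
          r * (∑[ i < n ] matrix F v i)                  ≈⟨ *-congˡ (matrix-row F v) ⟩
          r * T ∎
          where open ≈

        total : νN * S + (r * T + r * T) ≈ νN * (r * T) + (S + νN * P)
        total = begin
          νN * S + (r * T + r * T)
            ≈⟨ +-cong (*-distribˡ-sum {n} νN Sₓ) (+-cong (sym cross) (sym (sum-δ v (const (r * T))))) ⟩
          (∑[ x < n ] νN * Sₓ x) + ((∑[ x < n ] Rₓ x) + (∑[ x < n ] δ v x * (r * T)))
            ≈⟨ trans (∑-distrib-+ {n} (λ x → νN * Sₓ x) (λ x → Rₓ x + δ v x * (r * T)))
                 (+-congˡ (∑-distrib-+ {n} Rₓ (λ x → δ v x * (r * T)))) ⟨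
          (∑[ x < n ] νN * Sₓ x + (Rₓ x + δ v x * (r * T)))
            ≈⟨ sum-cong-≋ {n} entry-row ⟩
          (∑[ x < n ] r * T + (Sₓ x + δ v x * (νN * P)))
            ≈⟨ trans (∑-distrib-+ {n} (λ x → r * T) (λ x → Sₓ x + δ v x * (νN * P)))
                 (+-congˡ (∑-distrib-+ {n} Sₓ (λ x → δ v x * (νN * P)))) ⟩
          sum {n} (const (r * T)) + (S + (∑[ x < n ] δ v x * (νN * P)))
            ≈⟨ +-cong (sum-const n (r * T)) (+-congˡ (sum-δ v (const (νN * P)))) ⟩
          νN * (r * T) + (S + νN * P) ∎
          where open ≈

        cancelled : (1# + k) * S ≈ k * r * T + νN * P
        -- With `νN` written as `1# + (1# + k)`, this is the part common to both sides of `total`.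
        cancelled = +-cancelˡ (r * T + (r * T + S)) (begin
          r * T + (r * T + S) + (1# + k) * S
            ≈⟨ solve 4 (λ x s k o → x :+ (x :+ s) :+ (o :+ k) :* s := s :+ (o :+ k) :* s :+ (x :+ x)) refl (r * T) S k 1# ⟩
          S + (1# + k) * S + (r * T + r * T)
            ≈⟨ +-congʳ (trans (+-congʳ (sym (*-identityˡ S))) (trans (sym (distribʳ S 1# (1# + k))) (*-congʳ (sym n≈2+k)))) ⟩
          νN * S + (r * T + r * T)
            ≈⟨ total ⟩
          νN * (r * T) + (S + νN * P)
            ≈⟨ +-congʳ (*-congʳ n≈2+k) ⟩
          (1# + (1# + k)) * (r * T) + (S + νN * P)
            ≈⟨ +-congʳ (trans (distribʳ (r * T) 1# (1# + k)) (+-cong (*-identityˡ (r * T))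
                 (trans (distribʳ (r * T) 1# k) (+-congʳ (*-identityˡ (r * T)))))) ⟩
          (r * T + (r * T + k * (r * T))) + (S + νN * P)
            ≈⟨ solve 5 (λ k r t s p → (r :* t :+ (r :* t :+ k :* (r :* t))) :+ (s :+ p) :=
                 r :* t :+ (r :* t :+ s) :+ (k :* r :* t :+ p))
                 refl k r T S (νN * P) ⟩
          r * T + (r * T + S) + (k * r * T + νN * P) ∎)
          where open ≈

      -- By `cancelled`, the trace part yields `k * r * T + νN * P`, and the constant part of
      -- `weight` removes `k * r * T`.
      Σₚ-weight : Σₚ (λ ζ → weight ζ * F ζ) ≈ fromℕ n * P
      Σₚ-weight = begin
        Σₚ (λ ζ → weight ζ * F ζ)
          ≈⟨ Σₚ-cong (λ ζ → trans (distribʳ (F ζ) ((1# + k) * trace ζ) (- (k * r)))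
               (+-congʳ (*-assoc (1# + k) (trace ζ) (F ζ)))) ⟩
        Σₚ (λ ζ → (1# + k) * (trace ζ * F ζ) + - (k * r) * F ζ)
          ≈⟨ Σₚ-+ (λ ζ → (1# + k) * (trace ζ * F ζ)) (λ ζ → - (k * r) * F ζ) ⟩
        Σₚ (λ ζ → (1# + k) * (trace ζ * F ζ)) + Σₚ (λ ζ → - (k * r) * F ζ)
          ≈⟨ +-cong (Σₚ-* (1# + k) (λ ζ → trace ζ * F ζ)) (Σₚ-* (- (k * r)) F) ⟨
        (1# + k) * Σₚ (λ ζ → trace ζ * F ζ) + - (k * r) * T
          ≈⟨ +-congʳ (*-congˡ (Σₚ-trace F)) ⟩
        (1# + k) * S + - (k * r) * T
          ≈⟨ +-congʳ cancelled ⟩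
        (k * r * T + νN * P) + - (k * r) * T
          ≈⟨ solve 4 (λ a b t p → (a :* t :+ p) :+ b :* t := (a :+ b) :* t :+ p)
               refl (k * r) (- (k * r)) T (νN * P) ⟩
        (k * r + - (k * r)) * T + νN * P
          ≈⟨ +-congʳ (trans (*-congʳ (-‿inverseʳ (k * r))) (zeroˡ T)) ⟩
        0# + νN * P
          ≈⟨ +-identityˡ (νN * P) ⟩
        νN * P ∎
        where open ≈

  one : Functional n
  one _ = 1#

  -- A constant functional is unchanged by translation along the transposition that exchanges the
  -- two rows.
  matrix-one : ∀ (x y : Fin n) i → matrix one x i ≈ matrix one y i
  matrix-one x y i = trans (reflexive (≡.cong (λ z → matrix one z i) (≡.sym (transpose-sends y x))))
                       (sym (matrix-translate one (λ _ _ _ → refl) (transpose y x) y i))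

  matrix-one-Σ : ∀ (v : Fin n) i → fromℕ n * matrix one v i ≈ Σₚ {n} one
  matrix-one-Σ {n} v i = begin
    fromℕ n * matrix one v i         ≈⟨ sum-const n _ ⟨
    (∑[ x < n ] matrix one v i)      ≈⟨ sum-cong-≋ {n} (λ x → matrix-one v x i) ⟩
    (∑[ x < n ] matrix one x i)      ≈⟨ matrix-column one i ⟩
    Σₚ one ∎
    where open ≈

  0<Σₚ-one : ∀ n → 0# < Σₚ {n} one
  0<Σₚ-one n = <-respʳ-≈ (sym (trans (Σₚ-def one) (trans (sum-const (n !) 1#) (*-identityʳ _)))) (0<fromℕ (n !) (ℕₚ.1≤n! n))
    where
    0<fromℕ : ∀ k → 1 ℕ.≤ k → 0# < fromℕ k
    0<fromℕ (suc k) _ = 0<fromℕ-suc k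

-- Facets of the permutahedron and weights that lead beyond them.

module FacetCut {c ℓ₁ ℓ₂ ℓ₃} (ℝ : RealField c ℓ₁ ℓ₂ ℓ₃) where
  open OrderedField ℝ
  open Averages ℝ
  open Geometry ℝ

  χ : Fin n → Carrier
  χ i = fromℕ (suc (toℕ i))

  coordinate : Fin n → Functional n
  coordinate x ζ = χ (ζ ⟨$⟩ˡ x)

  coordinate-cong : ∀ (x : Fin n) → Congruent (coordinate x)
  coordinate-cong x π ρ π≈ρ = reflexive (≡.cong χ (⟨$⟩ˡ-cong π ρ π≈ρ x))

  -- The transposition of two labels other than `x` leaves coordinate `x` unchanged and exchanges
  -- the corresponding rows.
  coordinate-special : ∀ (x : Fin n) → Special (matrix (coordinate x)) x
  coordinate-special x y z x≢y x≢z i = begin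
    matrix (coordinate x) y i
      ≈⟨ reflexive (≡.cong (λ a → matrix (coordinate x) a i) (transpose-sends z y)) ⟨
    matrix (coordinate x) (π ⟨$⟩ʳ z) i
      ≈⟨ matrix-translate (coordinate x) (coordinate-cong x) π z i ⟨
    matrix (λ ζ → coordinate x (ζ ∘ₚ π)) z i
      ≈⟨ matrix-cong (λ ζ → reflexive (≡.cong (λ a → χ (ζ ⟨$⟩ˡ a)) (transpose-fixes x≢y x≢z))) z i ⟩
    matrix (coordinate x) z i ∎
    where
    open ≈
    π = transpose z y

  matrix-coordinate : ∀ (x : Fin n) i → fromℕ n * matrix (coordinate x) x i ≈ Σₚ {n} one * χ i
  matrix-coordinate {n} x i = begin
    fromℕ n * matrix (coordinate x) x i
      ≈⟨ *-congˡ (matrix-cong (λ ζ → *-identityʳ (coordinate x ζ)) x i) ⟨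
    fromℕ n * matrix (λ ζ → χ (ζ ⟨$⟩ˡ x) * one ζ) x i
      ≈⟨ *-congˡ (matrix-scale one x i χ) ⟩
    fromℕ n * (χ i * matrix one x i)
      ≈⟨ solve 3 (λ k a b → k :* (a :* b) := (k :* b) :* a) refl (fromℕ n) (χ i) (matrix one x i) ⟩
    (fromℕ n * matrix one x i) * χ i
      ≈⟨ *-congʳ (matrix-one-Σ x i) ⟩
    Σₚ one * χ i ∎
    where open ≈

  module Cut {n : ℕ} (k : Carrier) (n≈2+k : fromℕ n ≈ 1# + (1# + k)) (l h : Fin n) (h≡1+l : toℕ h ≡ suc (toℕ l)) where

    Low? : (v : Fin n) → Dec (toℕ v ℕ.≤ toℕ l)
    Low? v = toℕ v ℕₚ.≤? toℕ l

    complement : {A : Set ℓ} → Dec A → Carrier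
    complement (yes _) = 0#
    complement (no _)  = 1#

    low high : Fin n → Carrier
    low v  = indicator (Low? v)
    high v = complement (Low? v)

    data Side (v : Fin n) : Set ℓ₁ where
      lower : toℕ v ℕ.≤ toℕ l → low v ≈ 1# → high v ≈ 0# → Side v
      upper : toℕ l ℕ.< toℕ v → low v ≈ 0# → high v ≈ 1# → Side v

    side : ∀ v → Side v
    side v = go (Low? v) ≡.refl
      where
      go : (d : Dec (toℕ v ℕ.≤ toℕ l)) → Low? v ≡ d → Side v
      go (yes v≤l) e = lower v≤l (reflexive (≡.cong indicator e)) (reflexive (≡.cong complement e))
      go (no v≰l)  e = upper (ℕₚ.≰⇒> v≰l) (reflexive (≡.cong indicator e)) (reflexive (≡.cong complement e))

    low+high : ∀ v → low v + high v ≈ 1#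
    low+high v with side v
    ... | lower _ e f = trans (+-cong e f) (+-identityʳ 1#)
    ... | upper _ e f = trans (+-cong e f) (+-identityˡ 1#)

    0≤low : ∀ v → 0# ≤ low v
    0≤low v with side v
    ... | lower _ e _ = ≤-resp refl (sym e) (<⇒≤ 0<1)
    ... | upper _ e _ = ≤-reflexive (sym e)

    0≤high : ∀ v → 0# ≤ high v
    0≤high v with side v
    ... | lower _ _ e = ≤-reflexive (sym e)
    ... | upper _ _ e = ≤-resp refl (sym e) (<⇒≤ 0<1)

    low-l : low l ≈ 1#
    low-l with side l
    ... | lower _ e _ = e
    ... | upper l<l _ _ = contradiction l<l (ℕₚ.<-irrefl ≡.refl)

    high-h : high h ≈ 1#
    high-h with side h
    ... | lower h≤l _ _ = contradiction h≤l (ℕₚ.<⇒≱ (ℕₚ.≤-reflexive (≡.sym h≡1+l)))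
    ... | upper _ _ e = e

    -- `α` and `β` are the sizes of the two sides of the cut, and `Λ` is the least total that the
    -- lower coordinates of a vertex can have.
    α β Λ : Carrier
    α = sum low
    β = sum high
    Λ = ∑[ v < n ] low v * χ v

    ¬¬0<α : ¬ ¬ (0# < α)
    ¬¬0<α = 0<sum 0≤low l (<-respʳ-≈ (sym low-l) 0<1)

    ¬¬0<β : ¬ ¬ (0# < β)
    ¬¬0<β = 0<sum 0≤high h (<-respʳ-≈ (sym high-h) 0<1)

    private
      bound : Fin n → Fin n → Carrier
      bound v i = low v * χ i + high v * χ l

      first : ∀ {a b x y} → a ≈ 1# → b ≈ 0# → a * x + b * y ≈ x
      first e f = trans (+-cong (trans (*-congʳ e) (*-identityˡ _)) (trans (*-congʳ f) (zeroˡ _))) (+-identityʳ _)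

      second : ∀ {a b x y} → a ≈ 0# → b ≈ 1# → a * x + b * y ≈ y
      second e f = trans (+-comm _ _) (first f e)

      -- `bound i i` is the minimum of `χ i` and `χ l`, while `bound v i` is one of these two
      -- values.
      bound-diagonal : ∀ v i → bound i i ≤ bound v i
      bound-diagonal v i with side v | side i
      ... | lower _ e f | lower _ e′ f′ = ≤-reflexive (+-cong (*-congʳ (trans e′ (sym e))) (*-congʳ (trans f′ (sym f))))
      ... | upper _ e f | upper _ e′ f′ = ≤-reflexive (+-cong (*-congʳ (trans e′ (sym e))) (*-congʳ (trans f′ (sym f))))
      ... | lower _ e f | upper l<i e′ f′ = ≤-resp (sym (second e′ f′)) (sym (first e f))
        (fromℕ-mono-≤ (ℕ.s≤s (ℕₚ.<⇒≤ l<i)))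
      ... | upper _ e f | lower i≤l e′ f′ = ≤-resp (sym (first e′ f′)) (sym (second e f))
        (fromℕ-mono-≤ (ℕ.s≤s i≤l))

    -- The slack of each position against the common threshold χ l makes the
    -- comparison with the identity pointwise.
    facet-vertex : ∀ (ζ : Permutation′ n) → Λ ≤ ∑[ v < n ] low v * χ (ζ ⟨$⟩ˡ v)
    facet-vertex ζ = +-cancelˡ-≤ (∑[ v < n ] high v * χ l) (≤-resp left right
      (sum-mono-≤ λ v → bound-diagonal v (ζ ⟨$⟩ˡ v)))
      where
      left : (∑[ v < n ] bound (ζ ⟨$⟩ˡ v) (ζ ⟨$⟩ˡ v)) ≈ (∑[ v < n ] high v * χ l) + Λ
      left = trans (sym (sum-permute (λ i → bound i i) (Perm.flip ζ)))
        (trans (∑-distrib-+ (λ v → low v * χ v) (λ v → high v * χ l)) (+-comm _ _))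
      right : (∑[ v < n ] bound v (ζ ⟨$⟩ˡ v)) ≈ (∑[ v < n ] high v * χ l) + (∑[ v < n ] low v * χ (ζ ⟨$⟩ˡ v))
      right = trans (∑-distrib-+ (λ v → low v * χ (ζ ⟨$⟩ˡ v)) (λ v → high v * χ l)) (+-comm _ _)

    facet : ∀ z → permutahedron n z → Λ ≤ ∑[ v < n ] low v * z v
    facet z (q , w , y , 0≤w , Σw≈1 , y∈ , z≋) = ≤-resp left right
      (sum-mono-≤ λ j → *-monoˡ-≤ (0≤w j) (≤-resp refl (vertex j) (facet-vertex (proj₁ (y∈ j)))))
      where
      open ≈
      vertex : ∀ j → (∑[ v < n ] low v * χ (proj₁ (y∈ j) ⟨$⟩ˡ v)) ≈ (∑[ v < n ] low v * y j v)
      vertex j = sum-cong-≋ {n} λ v → *-congˡ (sym (proj₂ (y∈ j) v))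
      left : (∑[ j < q ] w j * Λ) ≈ Λ
      left = trans (sym (*-distribʳ-sum Λ w)) (trans (*-congʳ Σw≈1) (*-identityˡ Λ))
      right : (∑[ j < q ] w j * (∑[ v < n ] low v * y j v)) ≈ (∑[ v < n ] low v * z v)
      right = begin
        (∑[ j < q ] w j * (∑[ v < n ] low v * y j v))
          ≈⟨ sum-cong-≋ {q} (λ j → trans (*-distribˡ-sum {n} (w j) (λ v → low v * y j v))
               (sum-cong-≋ {n} λ v → solve 3 (λ a b c → a :* (b :* c) := b :* (a :* c)) refl (w j) (low v) (y j v))) ⟩
        (∑[ j < q ] ∑[ v < n ] low v * (w j * y j v))
          ≈⟨ ∑-comm {q} {n} (λ j v → low v * (w j * y j v)) ⟩
        (∑[ v < n ] ∑[ j < q ] low v * (w j * y j v))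
          ≈⟨ sum-cong-≋ {n} (λ v → trans (sym (*-distribˡ-sum {q} (low v) (λ j → w j * y j v))) (*-congˡ (sym (z≋ v)))) ⟩
        (∑[ v < n ] low v * z v) ∎

    module Shift (K : Carrier) where

      -- Scaled by K, the average over the face where the lower positions carry
      -- the lower values, from which the lower positions take value l more often
      -- and value h less often, moving beyond the face.
      a a′ : Fin n → Carrier
      a i  = K * low i + (δ l i + - δ h i)
      a′ i = K * high i + (δ h i + - δ l i)

      shift-eval : ∀ (g f : Fin n → Carrier) x y →
        (∑[ i < n ] (K * g i + (δ x i + - δ y i)) * f i) ≈ K * (∑[ i < n ] g i * f i) + (f x + - f y)
      shift-eval g f x y = begin
        (∑[ i < n ] (K * g i + (δ x i + - δ y i)) * f i)
          ≈⟨ sum-cong-≋ {n} (λ i → trans (solve 5 (λ k g d e f → (k :* g :+ (d :+ e)) :* f := k :* (g :* f) :+ (d :* f :+ e :* f))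
                refl K (g i) (δ x i) (- δ y i) (f i))
                (+-congˡ (+-congˡ (trans (sym (-‿distribˡ-* (δ y i) (f i))) (-‿distribʳ-* (δ y i) (f i)))))) ⟩
        (∑[ i < n ] K * (g i * f i) + (δ x i * f i + δ y i * - f i))
          ≈⟨ trans (∑-distrib-+ {n} (λ i → K * (g i * f i)) (λ i → δ x i * f i + δ y i * - f i))
               (+-congˡ (∑-distrib-+ {n} (λ i → δ x i * f i) (λ i → δ y i * - f i))) ⟩
        (∑[ i < n ] K * (g i * f i)) + ((∑[ i < n ] δ x i * f i) + (∑[ i < n ] δ y i * - f i))
          ≈⟨ +-cong (sym (*-distribˡ-sum {n} K (λ i → g i * f i))) (+-cong (sum-δ x f) (sum-δ y (λ i → - f i))) ⟩
        K * (∑[ i < n ] g i * f i) + (f x + - f y) ∎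
        where open ≈

      shift-sum : ∀ g x y → (∑[ i < n ] K * g i + (δ x i + - δ y i)) ≈ K * sum g
      shift-sum g x y = begin
        (∑[ i < n ] K * g i + (δ x i + - δ y i))            ≈⟨ sum-cong-≋ {n} (λ i → *-identityʳ _) ⟨
        (∑[ i < n ] (K * g i + (δ x i + - δ y i)) * 1#)     ≈⟨ shift-eval g (const 1#) x y ⟩
        K * (∑[ i < n ] g i * 1#) + (1# + - 1#)
          ≈⟨ +-cong (*-congˡ (sum-cong-≋ {n} λ i → *-identityʳ (g i))) (-‿inverseʳ 1#) ⟩
        K * sum g + 0#                                      ≈⟨ +-identityʳ _ ⟩
        K * sum g ∎
        where open ≈

      -- `a` sums to `K * α` and `a′` to `K * β`, so the factors `β` and `α` equalise the row sums.
      -- The column sums agree with them because `a i + a′ i` is `K`.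
      m : Fin n → Fin n → Carrier
      m v i = low v * (β * a i) + high v * (α * a′ i)

      r : Carrier
      r = K * (α * β)

      m-eval : ∀ v (f : Fin n → Carrier) → (∑[ i < n ] m v i * f i) ≈
        low v * (β * (∑[ i < n ] a i * f i)) + high v * (α * (∑[ i < n ] a′ i * f i))
      m-eval v f = begin
        (∑[ i < n ] m v i * f i)
          ≈⟨ sum-cong-≋ {n} (λ i → solve 7 (λ p b x q c y f → (p :* (b :* x) :+ q :* (c :* y)) :* f :=
               (p :* b) :* (x :* f) :+ (q :* c) :* (y :* f)) refl (low v) β (a i) (high v) α (a′ i) (f i)) ⟩
        (∑[ i < n ] (low v * β) * (a i * f i) + (high v * α) * (a′ i * f i))
          ≈⟨ ∑-distrib-+ {n} (λ i → (low v * β) * (a i * f i)) (λ i → (high v * α) * (a′ i * f i)) ⟩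
        (∑[ i < n ] (low v * β) * (a i * f i)) + (∑[ i < n ] (high v * α) * (a′ i * f i))
          ≈⟨ +-cong (trans (sym (*-distribˡ-sum {n} (low v * β) (λ i → a i * f i))) (*-assoc _ _ _))
               (trans (sym (*-distribˡ-sum {n} (high v * α) (λ i → a′ i * f i))) (*-assoc _ _ _)) ⟩
        low v * (β * (∑[ i < n ] a i * f i)) + high v * (α * (∑[ i < n ] a′ i * f i)) ∎
        where open ≈

      m-row : ∀ v → (∑[ i < n ] m v i) ≈ r
      m-row v = begin
        (∑[ i < n ] m v i)          ≈⟨ sum-cong-≋ {n} (λ i → *-identityʳ _) ⟨
        (∑[ i < n ] m v i * 1#)     ≈⟨ m-eval v (const 1#) ⟩
        low v * (β * (∑[ i < n ] a i * 1#)) + high v * (α * (∑[ i < n ] a′ i * 1#))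
          ≈⟨ +-cong (*-congˡ (*-congˡ (trans (sum-cong-≋ {n} λ i → *-identityʳ _) (shift-sum low l h))))
               (*-congˡ (*-congˡ (trans (sum-cong-≋ {n} λ i → *-identityʳ _) (shift-sum high h l)))) ⟩
        low v * (β * (K * α)) + high v * (α * (K * β))
          ≈⟨ solve 5 (λ p q K a b → p :* (b :* (K :* a)) :+ q :* (a :* (K :* b)) := (p :+ q) :* (K :* (a :* b)))
               refl (low v) (high v) K α β ⟩
        (low v + high v) * r        ≈⟨ trans (*-congʳ (low+high v)) (*-identityˡ r) ⟩
        r ∎
        where open ≈

      m-column : ∀ i → (∑[ v < n ] m v i) ≈ r
      m-column i = begin
        (∑[ v < n ] m v i)
          ≈⟨ ∑-distrib-+ {n} (λ v → low v * (β * a i)) (λ v → high v * (α * a′ i)) ⟩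
        (∑[ v < n ] low v * (β * a i)) + (∑[ v < n ] high v * (α * a′ i))
          ≈⟨ +-cong (*-distribʳ-sum {n} (β * a i) low) (*-distribʳ-sum {n} (α * a′ i) high) ⟨
        α * (β * a i) + β * (α * a′ i)
          ≈⟨ solve 4 (λ x y a b → x :* (y :* a) :+ y :* (x :* b) := (a :+ b) :* (x :* y)) refl α β (a i) (a′ i) ⟩
        (a i + a′ i) * (α * β)
          ≈⟨ *-congʳ total ⟩
        r ∎
        where
        open ≈
        total : a i + a′ i ≈ K
        total = begin
          a i + a′ i
            ≈⟨ solve 7 (λ K p q d d′ e e′ → (K :* p :+ (d :+ e′)) :+ (K :* q :+ (e :+ d′)) :=
                 K :* (p :+ q) :+ ((d :+ d′) :+ (e :+ e′))) refl K (low i) (high i) (δ l i) (- δ l i) (δ h i) (- δ h i) ⟩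
          K * (low i + high i) + ((δ l i + - δ l i) + (δ h i + - δ h i))
            ≈⟨ +-cong (trans (*-congˡ (low+high i)) (*-identityʳ K)) (trans (+-cong (-‿inverseʳ _) (-‿inverseʳ _)) (+-identityʳ 0#)) ⟩
          K + 0#
            ≈⟨ +-identityʳ K ⟩
          K ∎

      open Weighted k n≈2+k m r m-row m-column public

      -- Needed to normalise the weights to an affine combination. All rows of `matrix one` agree,
      -- so any row counts as special; `l` is taken.
      Σₚ-weight-one : Σₚ weight ≈ r * Σₚ {n} one
      Σₚ-weight-one = begin
        Σₚ weight                                        ≈⟨ Σₚ-cong (λ ζ → *-identityʳ (weight ζ)) ⟨
        Σₚ (λ ζ → weight ζ * one ζ)                      ≈⟨ Σₚ-weight one {l} (λ x y _ _ → matrix-one x y) ⟩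
        fromℕ n * (∑[ i < n ] m l i * matrix one l i)    ≈⟨ *-distribˡ-sum {n} (fromℕ n) (λ i → m l i * matrix one l i) ⟩
        (∑[ i < n ] fromℕ n * (m l i * matrix one l i))
          ≈⟨ sum-cong-≋ {n} (λ i → trans (solve 3 (λ n m a → n :* (m :* a) := m :* (n :* a)) refl (fromℕ n) (m l i) (matrix one l i))
               (*-congˡ (matrix-one-Σ l i))) ⟩
        (∑[ i < n ] m l i * Σₚ one)                      ≈⟨ *-distribʳ-sum {n} (Σₚ one) (m l) ⟨
        (∑[ i < n ] m l i) * Σₚ one                      ≈⟨ *-congʳ (m-row l) ⟩
        r * Σₚ one ∎
        where open ≈

      Σₚ-weight-coordinate : ∀ x → Σₚ (λ ζ → weight ζ * coordinate x ζ) ≈ Σₚ {n} one * (∑[ i < n ] m x i * χ i)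
      Σₚ-weight-coordinate x = begin
        Σₚ (λ ζ → weight ζ * coordinate x ζ)
          ≈⟨ Σₚ-weight (coordinate x) (coordinate-special x) ⟩
        fromℕ n * (∑[ i < n ] m x i * matrix (coordinate x) x i)
          ≈⟨ *-distribˡ-sum {n} (fromℕ n) (λ i → m x i * matrix (coordinate x) x i) ⟩
        (∑[ i < n ] fromℕ n * (m x i * matrix (coordinate x) x i))
          ≈⟨ sum-cong-≋ {n} (λ i → trans
               (solve 3 (λ n m a → n :* (m :* a) := m :* (n :* a)) refl (fromℕ n) (m x i) (matrix (coordinate x) x i))
               (trans (*-congˡ (matrix-coordinate x i))
                 (solve 3 (λ m a b → m :* (a :* b) := a :* (m :* b)) refl (m x i) (Σₚ one) (χ i)))) ⟩
        (∑[ i < n ] Σₚ one * (m x i * χ i))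
          ≈⟨ *-distribˡ-sum {n} (Σₚ one) (λ i → m x i * χ i) ⟨
        Σₚ one * (∑[ i < n ] m x i * χ i) ∎
        where open ≈

      -- The shift replaces value `h` by `l`, which differ by one, so each of the `α` lower
      -- coordinates loses `β`, up to the factor `Σₚ one`. After normalisation the lower coordinates
      -- therefore fall short of `Λ`.
      Σ-low-coordinates : (∑[ x < n ] low x * Σₚ (λ ζ → weight ζ * coordinate x ζ)) + Σₚ {n} one * (α * β) ≈ r * Σₚ {n} one * Λ
      Σ-low-coordinates = begin
        (∑[ x < n ] low x * Σₚ (λ ζ → weight ζ * coordinate x ζ)) + N * (α * β)
          ≈⟨ +-congʳ (sum-cong-≋ {n} λ x → trans (*-congˡ (Σₚ-weight-coordinate x)) (restrict x)) ⟩
        (∑[ x < n ] low x * (N * (β * E))) + N * (α * β)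
          ≈⟨ +-congʳ (*-distribʳ-sum {n} (N * (β * E)) low) ⟨
        α * (N * (β * E)) + N * (α * β)
          ≈⟨ solve 4 (λ a N b E → a :* (N :* (b :* E)) :+ N :* (a :* b) := a :* (N :* b) :* (E :+ con 1)) refl α N β E ⟩
        α * (N * β) * (E + 1#)
          ≈⟨ *-congˡ E+1 ⟩
        α * (N * β) * (K * Λ)
          ≈⟨ solve 5 (λ a N b K L → a :* (N :* b) :* (K :* L) := K :* (a :* b) :* N :* L) refl α N β K Λ ⟩
        r * N * Λ ∎
        where
        open ≈
        N = Σₚ {n} one
        E = ∑[ i < n ] a i * χ i
        E′ = ∑[ i < n ] a′ i * χ i

        restrict : ∀ x → low x * (N * (∑[ i < n ] m x i * χ i)) ≈ low x * (N * (β * E))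
        restrict x with side x
        ... | upper _ e _ = trans (trans (*-congʳ e) (zeroˡ _)) (sym (trans (*-congʳ e) (zeroˡ _)))
        ... | lower _ e f = *-congˡ (*-congˡ (begin
          (∑[ i < n ] m x i * χ i)                    ≈⟨ m-eval x χ ⟩
          low x * (β * E) + high x * (α * E′)         ≈⟨ +-cong (trans (*-congʳ e) (*-identityˡ _)) (trans (*-congʳ f) (zeroˡ _)) ⟩
          β * E + 0#                                  ≈⟨ +-identityʳ _ ⟩
          β * E ∎))

        E+1 : E + 1# ≈ K * Λ
        E+1 = begin
          E + 1#                                  ≈⟨ +-congʳ (shift-eval low χ l h) ⟩
          K * Λ + (χ l + - χ h) + 1#
            ≈⟨ solve 4 (λ x y z o → x :+ (y :+ z) :+ o := x :+ ((o :+ y) :+ z)) refl (K * Λ) (χ l) (- χ h) 1# ⟩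
          K * Λ + ((1# + χ l) + - χ h)            ≈⟨ +-congˡ (+-congʳ (reflexive (≡.cong (λ t → fromℕ (suc t)) (≡.sym h≡1+l)))) ⟩
          K * Λ + (χ h + - χ h)                   ≈⟨ +-congˡ (-‿inverseʳ _) ⟩
          K * Λ + 0#                              ≈⟨ +-identityʳ _ ⟩
          K * Λ ∎

      -- Only row `v` matters by `Σₚ-weight`. Its sole negative contribution is the entry at `h` if
      -- `v` is lower, or at `l` if `v` is upper, and the hypotheses let the `K`-fold sum over that
      -- side absorb it.
      Σₚ-weight-nonneg : (F : Functional n) → (∀ ζ → 0# ≤ F ζ) → ∀ {v} → Special (matrix F) v →
        matrix F v h ≤ K * (∑[ i < n ] low i * matrix F v i) →
        matrix F v l ≤ K * (∑[ i < n ] high i * matrix F v i) →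
        0# ≤ Σₚ (λ ζ → weight ζ * F ζ)
      Σₚ-weight-nonneg F 0≤F {v} special low-bound high-bound =
        ≤-resp refl (sym (Σₚ-weight F special)) (0≤* (0≤fromℕ n) (≤-resp refl (sym (m-eval v A))
          (0≤+ (0≤* (0≤low v) (0≤* (0≤sum 0≤high) (part low l h low-bound (0≤matrix 0≤F v l))))
               (0≤* (0≤high v) (0≤* (0≤sum 0≤low) (part high h l high-bound (0≤matrix 0≤F v h)))))))
        where
        A : Fin n → Carrier
        A = matrix F v

        part : ∀ g x y → A y ≤ K * (∑[ i < n ] g i * A i) → 0# ≤ A x →
          0# ≤ (∑[ i < n ] (K * g i + (δ x i + - δ y i)) * A i)
        part g x y bound 0≤x = ≤-resp (-‿inverseʳ (A y))
          (trans (+-assoc _ (A x) (- A y)) (sym (shift-eval g A x y)))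
          (+-mono-≤ (≤-resp (+-identityʳ (A y)) refl (+-mono-≤ bound 0≤x)) (≤-reflexive refl))

-- Pivots: which functionals can become negative at a cut, and how often.

module Pivots {c ℓ₁ ℓ₂ ℓ₃} (ℝ : RealField c ℓ₁ ℓ₂ ℓ₃) where
  open OrderedField ℝ
  open Averages ℝ
  open FacetCut ℝ

  -- The support of row v begins (true) or ends (false) exactly at the cut
  -- between l and h.
  Pivot : Bool → (Fin n → Fin n → Carrier) → (v l h : Fin n) → Set ℓ₁
  Pivot true  M v l h = Special M v × (∀ i → toℕ i ℕ.≤ toℕ l → M v i ≈ 0#) × ¬ (M v h ≈ 0#)
  Pivot false M v l h = Special M v × (∀ i → toℕ l ℕ.< toℕ i → M v i ≈ 0#) × ¬ (M v l ≈ 0#)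

  upper-bound : (f : Fin d → ℕ) → ∃ λ K → ∀ i → f i ℕ.≤ K
  upper-bound {zero}  f = 0 , λ ()
  upper-bound {suc d} f with K , f≤K ← upper-bound (f ∘ suc) =
    f zero ℕ.⊔ K , λ { zero → ℕₚ.m≤m⊔n (f zero) K ; (suc i) → ℕₚ.≤-trans (f≤K i) (ℕₚ.m≤n⊔m (f zero) K) }

  module _ {n : ℕ} (k : Carrier) (n≈2+k : fromℕ n ≈ 1# + (1# + k)) (l h : Fin n) (h≡1+l : toℕ h ≡ suc (toℕ l)) where
    open Cut k n≈2+k l h h≡1+l

    -- By `¬¬-dominate` a suitable multiplier exists unless the row vanishes on the lower side but
    -- not at `h`, or on the upper side but not at `l`. These are the two kinds of pivot.
    ¬pivot⇒nonneg : (u : Fin d → Functional n) (v : Fin d → Fin n) →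
      (∀ j → Special (matrix (u j)) (v j)) → (∀ j ζ → 0# ≤ u j ζ) →
      (∀ b j → ¬ Pivot b (matrix (u j)) (v j) l h) →
      ¬ ¬ (∃ λ K → ∀ j → 0# ≤ Σₚ (λ ζ → Shift.weight (fromℕ (suc K)) ζ * u j ζ))
    ¬pivot⇒nonneg {d} u v special 0≤u none fail =
      ¬¬-∀ low-bound λ lo → ¬¬-∀ high-bound λ hi →
        let K₁ , ≤K₁ = upper-bound (proj₁ ∘ lo)
            K₂ , ≤K₂ = upper-bound (proj₁ ∘ hi)
        -- The scale is the successor of this maximum, hence positive, as the later normalisation
        -- requires.
        in fail (K₁ ℕ.⊔ K₂ , λ j →
             Shift.Σₚ-weight-nonneg (fromℕ (suc (K₁ ℕ.⊔ K₂))) (u j) (0≤u j) (special j)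
               (proj₂ (lo j) _ (ℕₚ.m≤n⇒m≤1+n (ℕₚ.≤-trans (≤K₁ j) (ℕₚ.m≤m⊔n K₁ K₂))))
               (proj₂ (hi j) _ (ℕₚ.m≤n⇒m≤1+n (ℕₚ.≤-trans (≤K₂ j) (ℕₚ.m≤n⊔m K₁ K₂)))))
      where
      A : ∀ j → Fin n → Carrier
      A j = matrix (u j) (v j)
      0≤A : ∀ j i → 0# ≤ A j i
      0≤A j = 0≤matrix (0≤u j) (v j)

      vanish : ∀ j (g : Fin n → Carrier) → (∀ i → 0# ≤ g i) → (∑[ i < n ] g i * A j i) ≈ 0# →
        ∀ i → g i ≈ 1# → A j i ≈ 0#
      vanish j g 0≤g e i gi≈1 = trans (sym (trans (*-congʳ gi≈1) (*-identityˡ _)))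
        (nonneg-sum-zero (λ i → 0≤* (0≤g i) (0≤A j i)) e i)

      low-1 : ∀ i → toℕ i ℕ.≤ toℕ l → low i ≈ 1#
      low-1 i i≤l with side i
      ... | lower _ e _ = e
      ... | upper l<i _ _ = contradiction i≤l (ℕₚ.<⇒≱ l<i)

      high-1 : ∀ i → toℕ l ℕ.< toℕ i → high i ≈ 1#
      high-1 i l<i with side i
      ... | lower i≤l _ _ = contradiction i≤l (ℕₚ.<⇒≱ l<i)
      ... | upper _ _ e = e

      low-bound : ∀ j → ¬ ¬ (∃ λ K → ∀ L → K ℕ.≤ L → A j h ≤ fromℕ L * (∑[ i < n ] low i * A j i))
      low-bound j = ¬¬-dominate (0≤sum λ i → 0≤* (0≤low i) (0≤A j i)) λ e → ≈-stable λ ≉0 →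
        none true j (special j , (λ i i≤l → vanish j low 0≤low e i (low-1 i i≤l)) , ≉0)

      high-bound : ∀ j → ¬ ¬ (∃ λ K → ∀ L → K ℕ.≤ L → A j l ≤ fromℕ L * (∑[ i < n ] high i * A j i))
      high-bound j = ¬¬-dominate (0≤sum λ i → 0≤* (0≤high i) (0≤A j i)) λ e → ≈-stable λ ≉0 →
        none false j (special j , (λ i l<i → vanish j high 0≤high e i (high-1 i l<i)) , ≉0)

  module _ {n : ℕ} (F : Functional (3 ℕ.+ n)) where
    private
      N = 3 ℕ.+ n
      M = matrix F

    -- A third row `x` agrees with every row other than `v` because `v` is special, and with `v`
    -- because `w` is special. So all rows agree, and the column sum gives their entries.
    special-rows-equal : ∀ {v w} → v ≢ w → Special M v → Special M w → ∀ y i → fromℕ N * M y i ≈ Σₚ F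
    special-rows-equal {v} {w} v≢w sv sw y i = trans (sym (sum-const N (M y i)))
      (trans (sum-cong-≋ {N} λ z → agree y z) (matrix-column F i))
      where
      w′ = punchOut v≢w
      x = punchIn v (punchIn w′ zero)
      v≢x : v ≢ x
      v≢x = punchInᵢ≢i v _ ∘ ≡.sym
      w≢x : w ≢ x
      w≢x e = punchInᵢ≢i w′ zero (≡.sym (punchIn-injective v _ _ (≡.trans (punchIn-punchOut v≢w) e)))
      agree-x : ∀ y → M y i ≈ M x i
      agree-x y with v ≟ y
      ... | no v≢y = sv y x v≢y v≢x i
      ... | yes ≡.refl = sw y x (v≢w ∘ ≡.sym) w≢x i
      agree : ∀ y z → M y i ≈ M z i
      agree y z = trans (agree-x y) (sym (agree-x z))

    pivot-special : ∀ b {v l h} → Pivot b M v l h → Special M v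
    pivot-special true  = proj₁
    pivot-special false = proj₁

    pivot-jump : ∀ b {v l h} → toℕ h ≡ suc (toℕ l) → Pivot b M v l h → ¬ (M v l ≈ M v h)
    pivot-jump true h≡1+l (_ , z , nz) e = nz (trans (sym e) (z _ ℕₚ.≤-refl))
    pivot-jump false h≡1+l (_ , z , nz) e = nz (trans e (z _ (ℕₚ.≤-reflexive (≡.sym h≡1+l))))

    -- Two different special rows would make every row constant, but a pivot row takes different
    -- values at `l` and `h`.
    pivot-row-unique : ∀ b b′ {v l h v′ l′ h′} → toℕ h ≡ suc (toℕ l) →
      Pivot b M v l h → Pivot b′ M v′ l′ h′ → v ≡ v′
    pivot-row-unique b b′ {v} {l} {h} {v′} h≡1+l p p′ = decidable-stable (v ≟ v′) λ v≢v′ →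
      let all = special-rows-equal v≢v′ (pivot-special b p) (pivot-special b′ p′) v
      in pivot-jump b h≡1+l p (*-cancelˡ (0<fromℕ-suc (2 ℕ.+ n)) (trans (all l) (sym (all h))))

    -- For a fixed kind `b`, the cut is determined by where the support of the row begins or ends.
    pivot-cut-unique : ∀ b {v l h l′ h′} → toℕ h ≡ suc (toℕ l) → toℕ h′ ≡ suc (toℕ l′) →
      Pivot b M v l h → Pivot b M v l′ h′ → toℕ l ≡ toℕ l′
    pivot-cut-unique b {v} {l} {h} {l′} {h′} e e′ p p′ =
      ℕₚ.≤-antisym (ℕₚ.≮⇒≥ (not-before b e′ p′ p)) (ℕₚ.≮⇒≥ (not-before b e p p′))
      where
      not-before : ∀ b {l h l′ h′} → toℕ h ≡ suc (toℕ l) →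
        Pivot b M v l h → Pivot b M v l′ h′ → ¬ (toℕ l ℕ.< toℕ l′)
      not-before true  e (_ , _ , nz) (_ , z , _) l<l′ = nz (z _ (ℕₚ.≤-trans (ℕₚ.≤-reflexive e) l<l′))
      not-before false e (_ , z , _) (_ , _ , nz) l<l′ = nz (z _ l<l′)

  pivot-transport : ∀ b (M M′ : Fin n → Fin n → Carrier) (π : Permutation′ n) →
    (∀ x i → M′ x i ≈ M (π ⟨$⟩ʳ x) i) → ∀ {v v′ l h} → π ⟨$⟩ʳ v′ ≡ v → Pivot b M v l h → Pivot b M′ v′ l h
  pivot-transport b M M′ π M′≈M {v} {v′} ≡.refl = go b
    where
    special : Special M v → Special M′ v′
    special s x y v′≢x v′≢y i = trans (M′≈M x i) (trans
      (s _ _ (v′≢x ∘ inj) (v′≢y ∘ inj) i) (sym (M′≈M y i)))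
      where
      inj : ∀ {x} → π ⟨$⟩ʳ v′ ≡ π ⟨$⟩ʳ x → v′ ≡ x
      inj e = ≡.trans (≡.sym (Perm.inverseˡ π)) (≡.trans (≡.cong (π ⟨$⟩ˡ_) e) (Perm.inverseˡ π))
    go : ∀ b {l h} → Pivot b M v l h → Pivot b M′ v′ l h
    go true  (s , z , nz) = special s , (λ i le → trans (M′≈M v′ i) (z i le)) , nz ∘ trans (sym (M′≈M v′ _))
    go false (s , z , nz) = special s , (λ i le → trans (M′≈M v′ i) (z i le)) , nz ∘ trans (sym (M′≈M v′ _))

  -- A functional has pivots for at most one row, and there at most one
  -- initial and one final cut.
  pivot-count : (u : Fin d → Functional (3 ℕ.+ n)) →
    (∀ v (w : Fin (2 ℕ.+ n)) → ∃₂ λ b j → Pivot b (matrix (u j)) v (inject₁ w) (suc w)) →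
    (3 ℕ.+ n) ℕ.* (2 ℕ.+ n) ℕ.≤ d ℕ.* 2
  pivot-count {d} {n} u pivot = injective⇒≤ {f = f} f-injective
    where
    bit : Bool → Fin 2
    bit true  = zero
    bit false = suc zero
    bit-injective : ∀ b b′ → bit b ≡ bit b′ → b ≡ b′
    bit-injective true  true  _ = ≡.refl
    bit-injective false false _ = ≡.refl
    cut : ∀ w → toℕ (suc w) ≡ suc (toℕ (inject₁ w))
    cut w = ≡.cong suc (≡.sym (toℕ-inject₁ w))

    g : Fin (3 ℕ.+ n) × Fin (2 ℕ.+ n) → Fin (d ℕ.* 2)
    g (v , w) = combine (proj₁ (proj₂ (pivot v w))) (bit (proj₁ (pivot v w)))

    g-injective : ∀ x y → g x ≡ g y → x ≡ y
    g-injective (v , w) (v′ , w′) e = conclude (pivot v w) (pivot v′ w′) e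
      where
      conclude : (p : ∃₂ λ b j → Pivot b (matrix (u j)) v (inject₁ w) (suc w))
                 (p′ : ∃₂ λ b j → Pivot b (matrix (u j)) v′ (inject₁ w′) (suc w′)) →
                 combine (proj₁ (proj₂ p)) (bit (proj₁ p)) ≡ combine (proj₁ (proj₂ p′)) (bit (proj₁ p′)) →
                 (v , w) ≡ (v′ , w′)
      conclude (b , j , p) (b′ , j′ , p′) e with combine-injective j (bit b) j′ (bit b′) e
      ... | ≡.refl , bb with bit-injective b b′ bb
      ... | ≡.refl with pivot-row-unique (u j) b b (cut w) p p′
      ... | ≡.refl = ≡.cong (v ,_) (inject₁-injective (toℕ-injective (pivot-cut-unique (u j) b (cut w) (cut w′) p p′)))

    f : Fin ((3 ℕ.+ n) ℕ.* (2 ℕ.+ n)) → Fin (d ℕ.* 2)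
    f = g ∘ remQuot (2 ℕ.+ n)

    f-injective : ∀ {x y} → f x ≡ f y → x ≡ y
    f-injective {x} {y} e = ≡.trans (≡.sym (combine-remQuot {3 ℕ.+ n} (2 ℕ.+ n) x))
      (≡.trans (≡.cong (uncurry combine) (g-injective _ _ e)) (combine-remQuot {3 ℕ.+ n} (2 ℕ.+ n) y))

-- The section of a weakly symmetric extension as a family of functionals.

module SymmetricExtension {c ℓ₁ ℓ₂ ℓ₃} (ℝ : RealField c ℓ₁ ℓ₂ ℓ₃) where
  open Geometry ℝ
  open OrderedField ℝ
  open Averages ℝ
  open FacetCut ℝ

  module Lift {q l n d} (Q : Pred (Point d) q) (p : Point d → Point n)
    (extension : IsSubspaceExtension l (permutahedron n) Q p)
    (symmetry : IsWeaklySymmetric (vertices n) U (vertices-stable U) Q p) where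

    open IsSubspaceExtension extension
    open IsAffineSubspace isAffineSubspace
    open IsWeaklySymmetric symmetry using (s; s∈Q; fibre; symmetric) renaming (cong to s-cong)
    open LeftModuleMorphisms (rawLeftModule d) (rawLeftModule n) using (module IsLeftModuleHomomorphism)
    open IsLeftModuleHomomorphism isLinear

    vertex : Permutation′ n → Point n
    vertex ζ = ζ • basePoint n

    vertex∈ : ∀ ζ → vertex ζ ∈ vertices n
    vertex∈ ζ = ζ , λ _ → refl

    lifted : Permutation′ n → Point d
    lifted ζ = s (vertex ζ) (vertex∈ ζ)

    u : Fin d → Functional n
    u j ζ = lifted ζ j

    u-cong : ∀ j → Congruent (u j)
    u-cong j π ρ π≈ρ = s-cong (vertex∈ π) (vertex∈ ρ) (λ v → coordinate-cong v π ρ π≈ρ) j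

    0≤u : ∀ j ζ → 0# ≤ u j ζ
    0≤u j ζ = proj₂ (proj₁ Q≐L∩orthant (s∈Q (vertex ζ) (vertex∈ ζ))) j

    -- Weak symmetry identifies coordinate `j` of the section at the moved vertex with coordinate
    -- `ϰ ⟨$⟩ˡ j` at the original one, for all vertices at once.
    translated : ∀ π j → ∃ λ j′ → ∀ v i → matrix (u j′) v i ≈ matrix (u j) (π ⟨$⟩ʳ v) i
    translated π j with ϰ , s-π ← symmetric π _ =
      ϰ ⟨$⟩ˡ j , λ v i → trans
        (matrix-cong (λ ζ → sym (trans (s-cong (vertex∈ (ζ ∘ₚ π)) _ (λ _ → refl) j) (s-π (vertex ζ) (vertex∈ ζ) j))) v i)
        (matrix-translate (u j) (u-cong j) π v i)

    p-combination : ∀ {k} (w : Vector Carrier k) (y : Vector (Point d) k) →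
      p (combination w y) ≋ combination w (p ∘ y)
    p-combination {zero}  w y = 0ᴹ-homo
    p-combination {suc k} w y v = trans (+ᴹ-homo _ _ v)
      (+-cong (*ₗ-homo (w zero) (y zero) v) (p-combination (w ∘ suc) (y ∘ suc) v))

    module _ (k : Carrier) (n≈2+k : fromℕ n ≈ 1# + (1# + k)) (l h : Fin n) (h≡1+l : toℕ h ≡ suc (toℕ l)) (K : ℕ) where
      open Cut k n≈2+k l h h≡1+l
      open Shift (fromℕ (suc K))

      -- Otherwise the normalised combination `y` of lifted vertices would lie in the affine
      -- subspace and in the orthant, hence in `Q`, although its projection violates the facet
      -- inequality of the cut.
      ¬nonneg : ¬ (∀ j → 0# ≤ Σₚ (λ ζ → weight ζ * u j ζ))
      ¬nonneg 0≤Σ = ¬¬0<α λ 0<α → ¬¬0<β λ 0<β → violated 0<α 0<β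
        where
        N = Σₚ {n} one
        module _ (0<α : 0# < α) (0<β : 0# < β) where
          0<αβ : 0# < α * β
          0<αβ = *-pos 0<α 0<β
          0<rN : 0# < r * N
          0<rN = *-pos (*-pos (0<fromℕ-suc K) 0<αβ) (0<Σₚ-one n)
          ι = proj₁ (inverse 0<rN)
          ι-inverse : ι * (r * N) ≈ 1#
          ι-inverse = proj₂ (inverse 0<rN)
          0≤ι : 0# ≤ ι
          0≤ι = inverse-pos 0<rN ι-inverse

          w : Vector Carrier (n !)
          w j = ι * weight (perms n j)

          Σ-w : (F : Functional n) → (∑[ j < n ! ] w j * F (perms n j)) ≈ ι * Σₚ (λ ζ → weight ζ * F ζ)
          Σ-w F = trans (sum-cong-≋ {n !} λ j → *-assoc ι (weight (perms n j)) (F (perms n j)))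
            (trans (sym (*-distribˡ-sum {n !} ι (λ j → weight (perms n j) * F (perms n j))))
              (*-congˡ (sym (Σₚ-def (λ ζ → weight ζ * F ζ)))))

          sum-w : sum w ≈ 1#
          sum-w = trans (sym (*-distribˡ-sum {n !} ι (weight ∘ perms n)))
            (trans (*-congˡ (trans (sym (Σₚ-def weight)) Σₚ-weight-one)) ι-inverse)

          y : Point d
          y = combination w (lifted ∘ perms n)

          y∈Q : y ∈ Q
          y∈Q = proj₂ Q≐L∩orthant
            ( closed w (lifted ∘ perms n) sum-w (λ j → proj₁ (proj₁ Q≐L∩orthant (s∈Q _ (vertex∈ (perms n j)))))
            , λ j → ≤-resp refl (sym (Σ-w (u j))) (0≤* 0≤ι (0≤Σ j)))

          py∈P : permutahedron n (p y)
          py∈P = proj₁ projection (y , y∈Q , λ _ → refl)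

          py : ∀ x → p y x ≈ ι * Σₚ (λ ζ → weight ζ * coordinate x ζ)
          py x = trans (p-combination w (lifted ∘ perms n) x)
            (trans (sum-cong-≋ {n !} λ j → *-congˡ (fibre (vertex (perms n j)) (vertex∈ (perms n j)) x)) (Σ-w (coordinate x)))

          V = ∑[ x < n ] low x * p y x
          -- The amount by which the projection of `y` misses the facet inequality.
          t = ι * (N * (α * β))

          V+t≈Λ : V + t ≈ Λ
          V+t≈Λ = begin
            V + t
              ≈⟨ +-congʳ (sum-cong-≋ {n} λ x → trans (*-congˡ (py x))
                   (solve 3 (λ a b c → a :* (b :* c) := b :* (a :* c)) refl (low x) ι (Σₚ (λ ζ → weight ζ * coordinate x ζ)))) ⟩
            (∑[ x < n ] ι * (low x * Σₚ (λ ζ → weight ζ * coordinate x ζ))) + t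
              ≈⟨ +-congʳ (*-distribˡ-sum {n} ι (λ x → low x * Σₚ (λ ζ → weight ζ * coordinate x ζ))) ⟨
            ι * (∑[ x < n ] low x * Σₚ (λ ζ → weight ζ * coordinate x ζ)) + t
              ≈⟨ distribˡ ι _ _ ⟨
            ι * ((∑[ x < n ] low x * Σₚ (λ ζ → weight ζ * coordinate x ζ)) + N * (α * β))
              ≈⟨ *-congˡ Σ-low-coordinates ⟩
            ι * (r * N * Λ)
              ≈⟨ *-assoc ι (r * N) Λ ⟨
            ι * (r * N) * Λ
              ≈⟨ trans (*-congʳ ι-inverse) (*-identityˡ Λ) ⟩
            Λ ∎
            where open ≈

          t≉0 : ¬ (t ≈ 0#)
          -- `fromℕ (suc K) * t` equals `ι * (r * N)`, which is `1#`.
          t≉0 t≈0 = 0<⇒≉0 0<1 (trans (sym ι-inverse) (trans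
            (solve 4 (λ i K ab N → i :* (K :* ab :* N) := K :* (i :* (N :* ab))) refl ι (fromℕ (suc K)) (α * β) N)
            (trans (*-congˡ t≈0) (zeroʳ _))))

          violated = 0≤∧≉0⇒¬¬0< (0≤* 0≤ι (0≤* (<⇒≤ (0<Σₚ-one n)) (<⇒≤ 0<αβ))) t≉0 λ 0<t →
            facet (p y) py∈P (<-respˡ-≈ (+-identityʳ V) (<-respʳ-≈ V+t≈Λ (+-monoʳ-< V 0<t)))

open import Data.Nat.Base using (_*_; _∸_; _≤_)

-- The lower bound on the number of variables.

module LowerBound {c ℓ₁ ℓ₂ ℓ₃} (ℝ : RealField c ℓ₁ ℓ₂ ℓ₃) where
  open Geometry ℝ
  open OrderedField ℝ hiding (_≤_; _*_)
  open Averages ℝ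
  open Pivots ℝ

  module _ {q l n d} (Q : Pred (Point d) q) (p : Point d → Point (3 ℕ.+ n))
    (extension : IsSubspaceExtension l (permutahedron (3 ℕ.+ n)) Q p)
    (symmetry : IsWeaklySymmetric (vertices (3 ℕ.+ n)) U (vertices-stable U) Q p) where

    open SymmetricExtension ℝ
    open Lift Q p extension symmetry

    private
      M : Fin d → Fin (3 ℕ.+ n) → Fin (3 ℕ.+ n) → Carrier
      M j = matrix (u j)

    SameRow : Fin d → Fin (3 ℕ.+ n) → Fin (3 ℕ.+ n) → Set ℓ₁
    SameRow j x y = ∀ i → M j x i ≈ M j y i

    -- Each rearrangement of the rows of `M j` is the matrix of some coordinate, and a coordinate
    -- determines its matrix, so different rearrangements need different coordinates.
    generic⇒triangle≤ : ∀ j → IsDecEquivalence (SameRow j) → Generic (SameRow j) → triangle (3 ℕ.+ n) ≤ d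
    generic⇒triangle≤ j dec gen with π , π-injective ← generic⇒rearrangements (3 ℕ.+ n) (SameRow j) dec gen =
      injective⇒≤ {f = λ a → proj₁ (translated (π a) j)} λ {a} {b} e → π-injective λ x i →
        trans (sym (proj₂ (translated (π a) j) x i))
          (trans (reflexive (≡.cong (λ j′ → M j′ x i) e)) (proj₂ (translated (π b) j) x i))

    ¬generic⇒special : ∀ j → IsDecEquivalence (SameRow j) → ¬ Generic (SameRow j) → ∃ (Special (M j))
    ¬generic⇒special j dec ¬gen
      with v , ¬nc ← ¬∀⟶∃¬ _ _ (λ v → nonconstant? (On.isDecEquivalence (punchIn v) dec)) ¬gen =
      v , λ x y v≢x v≢y → ≡.subst₂ (SameRow j) (punchIn-punchOut v≢x) (punchIn-punchOut v≢y)
            (constant (On.isDecEquivalence (punchIn v) dec) ¬nc (punchOut v≢x) (punchOut v≢y))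

    module _ (special : ∀ j → ∃ (Special (M j))) where

      -- Without a pivot at the cut, some scale would make all coordinates nonnegative, which
      -- `¬nonneg` excludes.
      ¬¬pivot : ∀ (w : Fin (2 ℕ.+ n)) → ¬ ¬ (∃₂ λ b j → Pivot b (M j) (proj₁ (special j)) (inject₁ w) (suc w))
      ¬¬pivot w none = ¬pivot⇒nonneg (fromℕ (1 ℕ.+ n)) refl (inject₁ w) (suc w) cut u (proj₁ ∘ special)
        (proj₂ ∘ special) 0≤u (λ b j pivot → none (b , j , pivot))
        λ (K , 0≤Σ) → ¬nonneg (fromℕ (1 ℕ.+ n)) refl (inject₁ w) (suc w) cut K 0≤Σ
        where
        cut : toℕ (suc w) ≡ suc (toℕ (inject₁ w))
        cut = ≡.cong suc (≡.sym (toℕ-inject₁ w))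

      ¬¬double-bound : ¬ ¬ ((3 ℕ.+ n) * (2 ℕ.+ n) ≤ d * 2)
      ¬¬double-bound k = ¬¬-∀ ¬¬pivot λ pivot → k (pivot-count u λ v w →
        let b , j , pv = pivot w
            -- Permuting the rows of `M j` carries its pivot to the prescribed row `v` at the same
            -- cut.
            π = transpose v (proj₁ (special j))
            j′ , M′≈M = translated π j
        in b , j′ , pivot-transport b (M j) (M j′) π M′≈M (transpose-sends v _) pv)

    bound : (3 ℕ.+ n) * (2 ℕ.+ n) / 2 ≤ d
    bound = decidable-stable (_ ℕₚ.≤? _) λ ¬bound →
      -- Excluded middle is assumed for the finitely many equalities between matrix entries, which
      -- makes every `SameRow j` decidable. A generic coordinate would already give the bound, so
      -- each coordinate has a special row.
      ¬¬-∀ (λ j → ¬¬-∀ λ x → ¬¬-∀ λ y → ¬¬-∀ λ i → ¬¬-excluded-middle {A = M j x i ≈ M j y i}) λ dec →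
      let isDec : ∀ j → IsDecEquivalence (SameRow j)
          isDec j = record
            { isEquivalence = record
              { refl = λ i → refl ; sym = λ e i → sym (e i) ; trans = λ e f i → trans (e i) (f i) }
            ; _≟_ = λ x y → all? (dec j x y)
            }
          special : ∀ j → ∃ (Special (M j))
          special j = ¬generic⇒special j (isDec j) λ gen →
            ¬bound (≡.subst (_≤ d) (≡.sym (half-triangle (3 ℕ.+ n))) (generic⇒triangle≤ j (isDec j) gen))
      in ¬¬double-bound special λ le → ¬bound
           (≡.subst ((3 ℕ.+ n) * (2 ℕ.+ n) / 2 ≤_) (m*n/n≡m d 2) (/-mono-≤ {o = 2} le ℕₚ.≤-refl))

theorem3 : ∀ {c ℓ₁ ℓ₂ ℓ₃ q l : Level} (ℝ : RealField c ℓ₁ ℓ₂ ℓ₃) →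
    let open Geometry ℝ in
    (n : ℕ) → 6 ≤ n →
    (d : ℕ) (Q : Pred (Point d) q) (p : Point d → Point n) →
    IsSubspaceExtension l (permutahedron n) Q p →
    IsWeaklySymmetric (vertices n) U (vertices-stable U) Q p →
    n * (n ∸ 1) / 2 ≤ d
theorem3 ℝ 1 (s≤s ())
theorem3 ℝ 2 (s≤s (s≤s ()))
theorem3 ℝ (suc (suc (suc n))) _ d Q p extension symmetry = LowerBound.bound ℝ Q p extension symmetry
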